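{- Let $\lambda$ be a nonzero real number and $n$ a positive integer. Then, as polynomials in $x$, $$\phi_{n+1,\lambda}(x)=x\phi_{n,\lambda}(x)+\Big(x\frac{d}{dx}-n\lambda\Big)\phi_{n,\lambda}(x)=x\sum_{k=0}^{n}\binom{n}{k}(1-\lambda)_{n-k,\lambda}\,\phi_{k,\lambda}(x).$$
   Context: For real $y$ and integer $k\ge0$: $(y)_{0,\lambda}=1$, $(y)_{k,\lambda}=y(y-\lambda)\cdots(y-(k-1)\lambda)$. The degenerate exponential is $e_\lambda(t)=\sum_{k\ge0}(1)_{k,\lambda}t^k/k!=(1+\lambda t)^{1/\lambda}$. The degenerate Bell polynomials $\phi_{n,\lambda}(x)$ are defined by $e^{x(e_\lambda(t)-1)}=\sum_{n\ge0}\phi_{n,\lambda}(x)\frac{t^n}{n!}$. -}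

module Defs where

open import Algebra.Bundles using (CommutativeRing; RawRing)
open import Algebra.Structures using (IsCommutativeRing)
import Algebra.Definitions.RawSemiring as RawSemiringDefs
open import Data.Fin.Base using (toℕ)
import Data.Integer.Base as ℤ
open import Data.List.Base using (List; []; _∷_; map)
open import Data.Nat.Base as ℕ using (ℕ; zero; suc; _∸_; _⊔_; _!)
import Data.Nat.Properties as ℕ
open import Data.Product.Base using (_×_; _,_; ∃)
open import Data.Rational.Base as ℚ using (ℚ; 0ℚ; 1ℚ; ½; ∣_∣)
import Data.Rational.Properties as ℚ
open import Data.Rational.Solver using (module +-*-Solver)
open import Level using (0ℓ)
open import Relation.Binary.Structures using (IsEquivalence)
open import Relation.Binary.PropositionalEquality using (_≡_; refl; sym; trans; cong; subst)

------------------------------------------------------------------------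
-- Real numbers: Cauchy sequences of rationals, with "the difference tends
-- to zero" as the setoid equality.

infix 4 _≃_

record ℝ : Set where
  constructor mkℝ
  field
    seq    : ℕ → ℚ
    cauchy : ∀ ε → 0ℚ ℚ.< ε →
             ∃ λ N → ∀ m n → N ℕ.≤ m → N ℕ.≤ n → ∣ seq m ℚ.- seq n ∣ ℚ.< ε

open ℝ public

_≃_ : ℝ → ℝ → Set
x ≃ y = ∀ ε → 0ℚ ℚ.< ε → ∃ λ N → ∀ n → N ℕ.≤ n → ∣ seq x n ℚ.- seq y n ∣ ℚ.< ε

private
  half-pos : ∀ {ε} → 0ℚ ℚ.< ε → 0ℚ ℚ.< ½ ℚ.* ε
  half-pos {ε} 0<ε = ℚ.positive⁻¹ (½ ℚ.* ε) {{ℚ.pos*pos⇒pos ½ ε {{ℚ.positive 0<ε}}}}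

  half+half : ∀ ε → ½ ℚ.* ε ℚ.+ ½ ℚ.* ε ≡ ε
  half+half ε = trans (sym (ℚ.*-distribʳ-+ ε ½ ½)) (ℚ.*-identityˡ ε)

  ∣p-p∣≡0 : ∀ p → ∣ p ℚ.- p ∣ ≡ 0ℚ
  ∣p-p∣≡0 p = cong ∣_∣ (ℚ.+-inverseʳ p)

  ∣p-q∣≡∣q-p∣ : ∀ p q → ∣ p ℚ.- q ∣ ≡ ∣ q ℚ.- p ∣
  ∣p-q∣≡∣q-p∣ p q = trans (cong ∣_∣ (eq p q)) (ℚ.∣-p∣≡∣p∣ (q ℚ.- p))
    where
    open +-*-Solver
    eq : ∀ p q → p ℚ.- q ≡ ℚ.- (q ℚ.- p)
    eq = solve 2 (λ p q → p :- q := :- (q :- p)) refl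

  add-close : ∀ ε a b → ∣ a ∣ ℚ.< ½ ℚ.* ε → ∣ b ∣ ℚ.< ½ ℚ.* ε → ∣ a ℚ.+ b ∣ ℚ.< ε
  add-close ε a b a< b< = ℚ.≤-<-trans (ℚ.∣p+q∣≤∣p∣+∣q∣ a b)
    (subst (∣ a ∣ ℚ.+ ∣ b ∣ ℚ.<_) (half+half ε) (ℚ.+-mono-< a< b<))

  +-close : ∀ ε a b c d → ∣ a ℚ.- c ∣ ℚ.< ½ ℚ.* ε → ∣ b ℚ.- d ∣ ℚ.< ½ ℚ.* ε →
            ∣ (a ℚ.+ b) ℚ.- (c ℚ.+ d) ∣ ℚ.< ε
  +-close ε a b c d p q =
    subst (λ z → ∣ z ∣ ℚ.< ε) (sym (eq a b c d)) (add-close ε (a ℚ.- c) (b ℚ.- d) p q)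
    where
    open +-*-Solver
    eq : ∀ a b c d → (a ℚ.+ b) ℚ.- (c ℚ.+ d) ≡ (a ℚ.- c) ℚ.+ (b ℚ.- d)
    eq = solve 4 (λ a b c d → (a :+ b) :- (c :+ d) := (a :- c) :+ (b :- d)) refl

  trans-close : ∀ ε a b c → ∣ a ℚ.- b ∣ ℚ.< ½ ℚ.* ε → ∣ b ℚ.- c ∣ ℚ.< ½ ℚ.* ε →
                ∣ a ℚ.- c ∣ ℚ.< ε
  trans-close ε a b c p q =
    subst (λ z → ∣ z ∣ ℚ.< ε) (sym (eq a b c)) (add-close ε (a ℚ.- b) (b ℚ.- c) p q)
    where
    open +-*-Solver
    eq : ∀ a b c → a ℚ.- c ≡ (a ℚ.- b) ℚ.+ (b ℚ.- c)
    eq = solve 3 (λ a b c → a :- c := (a :- b) :+ (b :- c)) refl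

  neg-close : ∀ ε a b → ∣ a ℚ.- b ∣ ℚ.< ε → ∣ (ℚ.- a) ℚ.- (ℚ.- b) ∣ ℚ.< ε
  neg-close ε a b = subst (ℚ._< ε)
    (trans (∣p-q∣≡∣q-p∣ a b) (cong ∣_∣ (eq a b)))
    where
    open +-*-Solver
    eq : ∀ a b → b ℚ.- a ≡ (ℚ.- a) ℚ.- (ℚ.- b)
    eq = solve 2 (λ a b → b :- a := (:- a) :- (:- b)) refl

  Bounded : (ℕ → ℚ) → ℚ → Set
  Bounded s B = ∃ λ N → ∀ n → N ℕ.≤ n → ∣ s n ∣ ℚ.< B

  bounded : ∀ x → ∃ λ B → 0ℚ ℚ.< B × Bounded (seq x) B
  bounded x with cauchy x 1ℚ (ℚ.positive⁻¹ 1ℚ)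
  ... | N , close = 1ℚ ℚ.+ ∣ seq x N ∣
      , ℚ.+-mono-<-≤ (ℚ.positive⁻¹ 1ℚ) (ℚ.0≤∣p∣ (seq x N))
      , N , λ n N≤n → ℚ.≤-<-trans
          (subst (λ z → ∣ z ∣ ℚ.≤ ∣ seq x n ℚ.- seq x N ∣ ℚ.+ ∣ seq x N ∣) (eq (seq x n) (seq x N))
            (ℚ.∣p+q∣≤∣p∣+∣q∣ (seq x n ℚ.- seq x N) (seq x N)))
          (ℚ.+-monoˡ-< ∣ seq x N ∣ (close n N N≤n ℕ.≤-refl))
    where
    open +-*-Solver
    eq : ∀ a b → (a ℚ.- b) ℚ.+ b ≡ a
    eq = solve 2 (λ a b → (a :- b) :+ b := a) refl

  shrink : ∀ {ε B} → 0ℚ ℚ.< ε → 0ℚ ℚ.< B → ∃ λ δ → 0ℚ ℚ.< δ × B ℚ.* δ ≡ ε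
  shrink {ε} {B} 0<ε 0<B =
    inv ℚ.* ε
    , ℚ.positive⁻¹ (inv ℚ.* ε)
        {{ℚ.pos*pos⇒pos inv {{ℚ.1/pos⇒pos B {{posB}}}} ε {{ℚ.positive 0<ε}}}}
    , trans (sym (ℚ.*-assoc B inv ε))
        (trans (cong (ℚ._* ε) (ℚ.*-inverseʳ B {{nzB}})) (ℚ.*-identityˡ ε))
    where
    posB = ℚ.positive 0<B
    nzB = ℚ.pos⇒nonZero B {{posB}}
    inv = (ℚ.1/ B) {{nzB}}

  prod-small : ∀ {B δ} a b → 0ℚ ℚ.< B → ∣ a ∣ ℚ.< B → ∣ b ∣ ℚ.< δ → ∣ a ℚ.* b ∣ ℚ.< B ℚ.* δ
  prod-small {B} {δ} a b 0<B a<B b<δ = subst (ℚ._< B ℚ.* δ) (sym (ℚ.∣p*q∣≡∣p∣*∣q∣ a b))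
    (ℚ.≤-<-trans
      (ℚ.*-monoʳ-≤-nonNeg ∣ b ∣ {{ℚ.∣-∣-nonNeg b}} (ℚ.<⇒≤ a<B))
      (ℚ.*-monoʳ-<-pos B {{ℚ.positive 0<B}} b<δ))

  *-close : ∀ ε a b c d → ∣ a ℚ.* (b ℚ.- d) ∣ ℚ.< ½ ℚ.* ε → ∣ d ℚ.* (a ℚ.- c) ∣ ℚ.< ½ ℚ.* ε →
            ∣ a ℚ.* b ℚ.- c ℚ.* d ∣ ℚ.< ε
  *-close ε a b c d p q = subst (λ z → ∣ z ∣ ℚ.< ε) (sym (eq a b c d))
    (add-close ε (a ℚ.* (b ℚ.- d)) (d ℚ.* (a ℚ.- c)) p q)
    where
    open +-*-Solver
    eq : ∀ a b c d → a ℚ.* b ℚ.- c ℚ.* d ≡ a ℚ.* (b ℚ.- d) ℚ.+ d ℚ.* (a ℚ.- c)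
    eq = solve 4 (λ a b c d → a :* b :- c :* d := a :* (b :- d) :+ d :* (a :- c)) refl

  ⊔₁ : ∀ {m n o} → m ⊔ n ℕ.≤ o → m ℕ.≤ o
  ⊔₁ {m} {n} = ℕ.m⊔n≤o⇒m≤o m n

  ⊔₂ : ∀ {m n o} → m ⊔ n ℕ.≤ o → n ℕ.≤ o
  ⊔₂ {m} {n} = ℕ.m⊔n≤o⇒n≤o m n

fromℚ : ℚ → ℝ
fromℚ q = mkℝ (λ _ → q) λ ε 0<ε → 0 , λ _ _ _ _ → subst (ℚ._< ε) (sym (∣p-p∣≡0 q)) 0<ε

infixl 6 _+ᵣ_
infixl 7 _*ᵣ_
infix  8 -ᵣ_

0ᵣ 1ᵣ : ℝ
0ᵣ = fromℚ 0ℚ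
1ᵣ = fromℚ 1ℚ

_+ᵣ_ : ℝ → ℝ → ℝ
x +ᵣ y = mkℝ (λ n → seq x n ℚ.+ seq y n) λ ε 0<ε →
  let M , p = cauchy x (½ ℚ.* ε) (half-pos 0<ε)
      N , q = cauchy y (½ ℚ.* ε) (half-pos 0<ε)
  in M ⊔ N , λ m n m≥ n≥ → +-close ε (seq x m) (seq y m) (seq x n) (seq y n)
       (p m n (⊔₁ m≥) (⊔₁ n≥)) (q m n (⊔₂ {M} m≥) (⊔₂ {M} n≥))

-ᵣ_ : ℝ → ℝ
-ᵣ x = mkℝ (λ n → ℚ.- seq x n) λ ε 0<ε →
  let N , p = cauchy x ε 0<ε
  in N , λ m n m≥ n≥ → neg-close ε (seq x m) (seq x n) (p m n m≥ n≥)

_*ᵣ_ : ℝ → ℝ → ℝ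
x *ᵣ y = mkℝ (λ n → seq x n ℚ.* seq y n) λ ε 0<ε →
  let A , 0<A , K , x<A = bounded x
      B , 0<B , L , y<B = bounded y
      α , 0<α , Aα = shrink (half-pos 0<ε) 0<A
      β , 0<β , Bβ = shrink (half-pos 0<ε) 0<B
      M , p = cauchy x β 0<β
      N , q = cauchy y α 0<α
  in (K ⊔ L) ⊔ (M ⊔ N) , λ m n m≥ n≥ → *-close ε (seq x m) (seq y m) (seq x n) (seq y n)
       (subst (_ ℚ.<_) Aα (prod-small (seq x m) (seq y m ℚ.- seq y n) 0<A
         (x<A m (⊔₁ (⊔₁ m≥)))
         (q m n (⊔₂ {M} (⊔₂ {K ⊔ L} m≥)) (⊔₂ {M} (⊔₂ {K ⊔ L} n≥)))))
       (subst (_ ℚ.<_) Bβ (prod-small (seq y n) (seq x m ℚ.- seq x n) 0<B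
         (y<B n (⊔₂ {K} (⊔₁ n≥)))
         (p m n (⊔₁ (⊔₂ {K ⊔ L} m≥)) (⊔₁ (⊔₂ {K ⊔ L} n≥)))))

private
  pointwise : ∀ {x y} → (∀ n → seq x n ≡ seq y n) → x ≃ y
  pointwise {x} {y} eq ε 0<ε = 0 , λ n _ → subst (ℚ._< ε)
    (sym (trans (cong (λ z → ∣ z ℚ.- seq y n ∣) (eq n)) (∣p-p∣≡0 (seq y n)))) 0<ε

  ≃-isEquivalence : IsEquivalence _≃_
  ≃-isEquivalence = record
    { refl  = λ {x} → pointwise {x} {x} λ _ → refl
    ; sym   = λ {x} {y} x≃y ε 0<ε →
        let N , p = x≃y ε 0<ε
        in N , λ n n≥ → subst (ℚ._< ε) (∣p-q∣≡∣q-p∣ (seq x n) (seq y n)) (p n n≥)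
    ; trans = λ {x} {y} {z} x≃y y≃z ε 0<ε →
        let M , p = x≃y (½ ℚ.* ε) (half-pos 0<ε)
            N , q = y≃z (½ ℚ.* ε) (half-pos 0<ε)
        in M ⊔ N , λ n n≥ → trans-close ε (seq x n) (seq y n) (seq z n)
             (p n (⊔₁ n≥)) (q n (⊔₂ {M} n≥))
    }

  +-cong : ∀ {x u y v} → x ≃ u → y ≃ v → x +ᵣ y ≃ u +ᵣ v
  +-cong {x} {u} {y} {v} x≃u y≃v ε 0<ε =
    let M , p = x≃u (½ ℚ.* ε) (half-pos 0<ε)
        N , q = y≃v (½ ℚ.* ε) (half-pos 0<ε)
    in M ⊔ N , λ n n≥ → +-close ε (seq x n) (seq y n) (seq u n) (seq v n)
         (p n (⊔₁ n≥)) (q n (⊔₂ {M} n≥))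

  -‿cong : ∀ {x y} → x ≃ y → -ᵣ x ≃ -ᵣ y
  -‿cong {x} {y} x≃y ε 0<ε =
    let N , p = x≃y ε 0<ε
    in N , λ n n≥ → neg-close ε (seq x n) (seq y n) (p n n≥)

  *-cong : ∀ {x u y v} → x ≃ u → y ≃ v → x *ᵣ y ≃ u *ᵣ v
  *-cong {x} {u} {y} {v} x≃u y≃v ε 0<ε =
    let A , 0<A , K , x<A = bounded x
        B , 0<B , L , v<B = bounded v
        α , 0<α , Aα = shrink (half-pos 0<ε) 0<A
        β , 0<β , Bβ = shrink (half-pos 0<ε) 0<B
        M , p = x≃u β 0<β
        N , q = y≃v α 0<α
    in (K ⊔ L) ⊔ (M ⊔ N) , λ n n≥ → *-close ε (seq x n) (seq y n) (seq u n) (seq v n)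
         (subst (_ ℚ.<_) Aα (prod-small (seq x n) (seq y n ℚ.- seq v n) 0<A
           (x<A n (⊔₁ (⊔₁ n≥))) (q n (⊔₂ {M} (⊔₂ {K ⊔ L} n≥)))))
         (subst (_ ℚ.<_) Bβ (prod-small (seq v n) (seq x n ℚ.- seq u n) 0<B
           (v<B n (⊔₂ {K} (⊔₁ n≥))) (p n (⊔₁ (⊔₂ {K ⊔ L} n≥)))))

  ℝ-isCommutativeRing : IsCommutativeRing _≃_ _+ᵣ_ _*ᵣ_ -ᵣ_ 0ᵣ 1ᵣ
  ℝ-isCommutativeRing = record
    { isRing = record
      { +-isAbelianGroup = record
        { isGroup = record
          { isMonoid = record
            { isSemigroup = record
              { isMagma = record
                { isEquivalence = ≃-isEquivalence
                ; ∙-cong = λ {x} {u} {y} {v} → +-cong {x} {u} {y} {v}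
                }
              ; assoc = λ x y z → pointwise {(x +ᵣ y) +ᵣ z} {x +ᵣ (y +ᵣ z)}
                  λ n → ℚ.+-assoc (seq x n) (seq y n) (seq z n)
              }
            ; identity =
                (λ x → pointwise {0ᵣ +ᵣ x} {x} λ n → ℚ.+-identityˡ (seq x n))
              , (λ x → pointwise {x +ᵣ 0ᵣ} {x} λ n → ℚ.+-identityʳ (seq x n))
            }
          ; inverse =
              (λ x → pointwise {(-ᵣ x) +ᵣ x} {0ᵣ} λ n → ℚ.+-inverseˡ (seq x n))
            , (λ x → pointwise {x +ᵣ (-ᵣ x)} {0ᵣ} λ n → ℚ.+-inverseʳ (seq x n))
          ; ⁻¹-cong = λ {x} {y} → -‿cong {x} {y}
          }
        ; comm = λ x y → pointwise {x +ᵣ y} {y +ᵣ x} λ n → ℚ.+-comm (seq x n) (seq y n)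
        }
      ; *-cong = λ {x} {u} {y} {v} → *-cong {x} {u} {y} {v}
      ; *-assoc = λ x y z → pointwise {(x *ᵣ y) *ᵣ z} {x *ᵣ (y *ᵣ z)}
          λ n → ℚ.*-assoc (seq x n) (seq y n) (seq z n)
      ; *-identity =
          (λ x → pointwise {1ᵣ *ᵣ x} {x} λ n → ℚ.*-identityˡ (seq x n))
        , (λ x → pointwise {x *ᵣ 1ᵣ} {x} λ n → ℚ.*-identityʳ (seq x n))
      ; distrib =
          (λ x y z → pointwise {x *ᵣ (y +ᵣ z)} {(x *ᵣ y) +ᵣ (x *ᵣ z)}
            λ n → ℚ.*-distribˡ-+ (seq x n) (seq y n) (seq z n))
        , (λ x y z → pointwise {(y +ᵣ z) *ᵣ x} {(y *ᵣ x) +ᵣ (z *ᵣ x)}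
            λ n → ℚ.*-distribʳ-+ (seq x n) (seq y n) (seq z n))
      }
    ; *-comm = λ x y → pointwise {x *ᵣ y} {y *ᵣ x} λ n → ℚ.*-comm (seq x n) (seq y n)
    }

ℝ-commutativeRing : CommutativeRing 0ℓ 0ℓ
ℝ-commutativeRing = record { isCommutativeRing = ℝ-isCommutativeRing }

------------------------------------------------------------------------
-- Finite sums  ∑_{k=0}^{n} f k

module Sum {c ℓ} (R : RawRing c ℓ) where
  open RawRing R
  open RawSemiringDefs rawSemiring using (sum)

  ∑≤ : ℕ → (ℕ → Carrier) → Carrier
  ∑≤ n f = sum {suc n} λ k → f (toℕ k)

------------------------------------------------------------------------
-- R[x].  The list a₀ ∷ a₁ ∷ … ∷ [] stands for a₀ + a₁x + …; trailing zeros
-- are allowed, so equality is coefficientwise.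

module Polynomial {c ℓ} (R : RawRing c ℓ) where
  open RawRing R
  open RawSemiringDefs rawSemiring using () renaming (_×_ to _·_)

  infix  4 _≈ₚ_
  infixl 6 _+ₚ_ _-ₚ_
  infixl 7 _*ₚ_
  infixr 7 _•_
  infix  8 -ₚ_

  Poly : Set c
  Poly = List Carrier

  coeff : Poly → ℕ → Carrier
  coeff []      _       = 0#
  coeff (a ∷ p) zero    = a
  coeff (a ∷ p) (suc i) = coeff p i

  _≈ₚ_ : Poly → Poly → Set ℓ
  p ≈ₚ q = ∀ i → coeff p i ≈ coeff q i

  const : Carrier → Poly
  const a = a ∷ []

  X : Poly
  X = 0# ∷ 1# ∷ []

  _+ₚ_ : Poly → Poly → Poly
  []      +ₚ q       = q
  (a ∷ p) +ₚ []      = a ∷ p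
  (a ∷ p) +ₚ (b ∷ q) = (a + b) ∷ (p +ₚ q)

  _•_ : Carrier → Poly → Poly
  a • p = map (a *_) p

  -ₚ_ : Poly → Poly
  -ₚ p = map (-_) p

  _-ₚ_ : Poly → Poly → Poly
  p -ₚ q = p +ₚ (-ₚ q)

  _*ₚ_ : Poly → Poly → Poly
  []      *ₚ q = []
  (a ∷ p) *ₚ q = (a • q) +ₚ (0# ∷ (p *ₚ q))

  -- weighted k (b₀ ∷ b₁ ∷ …) = k b₀ ∷ (k+1) b₁ ∷ …
  weighted : ℕ → Poly → Poly
  weighted k []      = []
  weighted k (b ∷ p) = (k · b) ∷ weighted (suc k) p

  d/dx : Poly → Poly
  d/dx []      = []
  d/dx (a ∷ p) = weighted 1 p

  polyRawRing : RawRing c ℓ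
  polyRawRing = record
    { Carrier = Poly ; _≈_ = _≈ₚ_ ; _+_ = _+ₚ_ ; _*_ = _*ₚ_ ; -_ = -ₚ_ ; 0# = [] ; 1# = const 1# }

------------------------------------------------------------------------
-- K[[t]]: the series f stands for ∑ₙ f n tⁿ.

module PowerSeries {c ℓ} (K : RawRing c ℓ) where
  open RawRing K
  open Sum K

  infixl 6 _-ₛ_
  infixl 7 _*ₛ_
  infixr 9 _∘ₛ_

  Series : Set c
  Series = ℕ → Carrier

  constₛ : Carrier → Series
  constₛ a zero    = a
  constₛ a (suc _) = 0#

  _*ₛ_ : Series → Series → Series
  (f *ₛ g) n = ∑≤ n λ i → f i * g (n ∸ i)

  seriesRawRing : RawRing c ℓ
  seriesRawRing = record
    { Carrier = Series
    ; _≈_     = λ f g → ∀ n → f n ≈ g n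
    ; _+_     = λ f g n → f n + g n
    ; _*_     = _*ₛ_
    ; -_      = λ f n → - f n
    ; 0#      = constₛ 0#
    ; 1#      = constₛ 1#
    }

  open RawSemiringDefs (RawRing.rawSemiring seriesRawRing) using () renaming (_^_ to _^ₛ_) public

  _-ₛ_ : Series → Series → Series
  (f -ₛ g) n = f n + - g n

  -- The composite g(f(t)) = ∑ₖ g k f(t)ᵏ, meaningful only for f with constant
  -- term zero: then f(t)ᵏ is divisible by tᵏ, and only k ≤ n contribute to tⁿ.
  _∘ₛ_ : Series → Series → Series
  (g ∘ₛ f) n = ∑≤ n λ k → g k * (f ^ₛ k) n

------------------------------------------------------------------------

module DegenerateBell {c ℓ} (R : RawRing c ℓ) (fromℚ : ℚ → RawRing.Carrier R) where
  open RawRing R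
  open RawSemiringDefs rawSemiring using () renaming (_×_ to _·_)
  open Polynomial R
  open PowerSeries polyRawRing
  open RawSemiringDefs (RawRing.rawSemiring polyRawRing) using () renaming (_×_ to _·ₚ_)

  1/_! : ℕ → Carrier
  1/ k ! = fromℚ (ℚ._/_ (ℤ.+ 1) (k !) {{k ℕ.!≢0}})

  -- falling y k l = (y)_{k,l} = y (y - l) ⋯ (y - (k-1) l)
  falling : Carrier → ℕ → Carrier → Carrier
  falling y zero    l = 1#
  falling y (suc k) l = falling y k l * (y + - (k · l))

  -- e^t, as a series over R[x]
  expₛ : Series
  expₛ k = const (1/ k !)

  -- e_l(t) = ∑ₖ (1)_{k,l} tᵏ / k!, as a series over R[x]
  degExpₛ : Carrier → Series
  degExpₛ l k = const (falling 1# k l * 1/ k !)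

  -- e^{x (e_l(t) - 1)}
  bellGF : Carrier → Series
  bellGF l = expₛ ∘ₛ (constₛ X *ₛ (degExpₛ l -ₛ constₛ (const 1#)))

  -- φ n l = φ_{n,l}(x), i.e. n! times the coefficient of tⁿ in bellGF l
  φ : ℕ → Carrier → Poly
  φ n l = (n !) ·ₚ bellGF l n

ℝ-rawRing : RawRing 0ℓ 0ℓ
ℝ-rawRing = CommutativeRing.rawRing ℝ-commutativeRing

open Polynomial ℝ-rawRing public
open DegenerateBell ℝ-rawRing fromℚ public using (falling; bellGF; φ)
open Sum polyRawRing public using () renaming (∑≤ to ∑ₚ≤)
open RawSemiringDefs (RawRing.rawSemiring ℝ-rawRing) public using () renaming (_×_ to _·ᵣ_)
open RawSemiringDefs (RawRing.rawSemiring polyRawRing) public using () renaming (_×_ to _·ₚ_)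

{-# OPTIONS --safe #-}
-- Write E = e^F with F = x (e_l(t) − 1).  Every derivation δ of R[x][[t]] satisfies δ E = E δ F.
-- Taking δ = d/dt gives E′ = x e_l′ E, whose coefficients are the convolution formula because
-- e_l′(t) = ∑ₖ (1−l)_{k,l} tᵏ/k!.  Combining δ = d/dt, t d/dt and x d/dx, together with
-- (1 + l t) e_l′ = e_l, gives (1 + l t) E′ = x e_l E = x E + x ∂E/∂x, whose coefficients are
-- the differential recurrence.
module Submission where

-- The composite E is given coefficientwise: its coefficient of tⁿ is a sum over k ≤ n, with a bound
-- that moves with n. So E is not a finite expression in the series ring, and a derivation cannot be
-- applied to it term by term. The rule δ E = E δ F is proved for finite truncations of the
-- exponential series and then carried to E one coefficient at a time. This works because F has no
-- constant term and each δ in use looks at most one degree ahead. The operator x d/dx enters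
-- because F is linear in x: x ∂F/∂x = F. Splitting e_l = 1 + (e_l - 1) in x e_l E leaves the
-- product E F, and that product is x ∂E/∂x. Division occurs only through elements `ι k` with k! ·
-- `ι k` = 1. The argument therefore runs over any commutative ring supplied with such elements, and
-- the real numbers enter only at the end.

open import Defs using (module Sum; module Polynomial; module PowerSeries; module DegenerateBell)
open import Algebra.Bundles using (CommutativeRing; RawRing)
open import Algebra.Structures using (IsCommutativeRing)
import Algebra.Definitions.RawMonoid as RawMonoidDefs
import Algebra.Definitions.RawSemiring as RawSemiringDefs
import Algebra.Morphism.RingMonomorphism as RingMonomorphism
open import Algebra.Morphism.Structures using (IsRingMonomorphism)
import Algebra.Properties.AbelianGroup as AbelianGroupProperties
import Algebra.Properties.CommutativeMonoid.Mult as CommutativeMonoidMult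
import Algebra.Properties.CommutativeSemigroup as CommutativeSemigroupProperties
import Algebra.Properties.Ring as RingProperties
import Algebra.Properties.Semiring.Mult as SemiringMult
import Data.Integer.Base as ℤ
import Data.Integer.Properties as ℤ
open import Data.Integer.Tactic.RingSolver using (solve-∀)
open import Data.List.Base using ([]; _∷_)
open import Data.Nat.Base as ℕ using (ℕ; zero; suc; _≤_; _∸_; _!; z≤n; s≤s)
import Data.Nat.Properties as ℕ
open import Data.Nat.Combinatorics using (_C_; nCk≡n!/k![n-k]!; k![n∸k]!∣n!)
open import Data.Nat.DivMod using (m/n*n≡m)
open import Data.Rational.Base as ℚ using (ℚ; 1ℚ; toℚᵘ)
import Data.Rational.Properties as ℚ
open import Data.Rational.Unnormalised.Base as ℚᵘ using (mkℚᵘ; *≡*)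
import Data.Rational.Unnormalised.Properties as ℚᵘ
open import Data.Product.Base using (_×_; _,_)
open import Function.Base using (_∘_; id)
import Relation.Binary.PropositionalEquality.Core as ≡
import Relation.Binary.Reasoning.Setoid as ≈-Reasoning
open import Level using (_⊔_)
open import Relation.Nullary.Negation.Core using (¬_)

-- Finite sums

module SumProperties {c ℓ} (R : CommutativeRing c ℓ) where
  open CommutativeRing R
  open CommutativeSemigroupProperties +-commutativeSemigroup using (interchange)
  open Sum rawRing public

  ∑-cong : ∀ n {f g : ℕ → Carrier} → (∀ k → k ≤ n → f k ≈ g k) → ∑≤ n f ≈ ∑≤ n g
  ∑-cong zero    f≈g = +-congʳ (f≈g 0 z≤n)
  ∑-cong (suc n) f≈g = +-cong (f≈g 0 z≤n) (∑-cong n λ k k≤n → f≈g (suc k) (s≤s k≤n))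

  ∑-zero : ∀ n {f : ℕ → Carrier} → (∀ k → k ≤ n → f k ≈ 0#) → ∑≤ n f ≈ 0#
  ∑-zero zero    f≈0 = trans (+-identityʳ _) (f≈0 0 z≤n)
  ∑-zero (suc n) f≈0 =
    trans (+-cong (f≈0 0 z≤n) (∑-zero n λ k k≤n → f≈0 (suc k) (s≤s k≤n))) (+-identityˡ 0#)

  ∑-distrib-+ : ∀ n (f g : ℕ → Carrier) → ∑≤ n (λ k → f k + g k) ≈ ∑≤ n f + ∑≤ n g
  ∑-distrib-+ zero    f g =
    trans (+-congˡ (sym (+-identityˡ 0#))) (interchange (f 0) (g 0) 0# 0#)
  ∑-distrib-+ (suc n) f g =
    trans (+-congˡ (∑-distrib-+ n (f ∘ suc) (g ∘ suc))) (interchange (f 0) (g 0) _ _)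

  ∑-truncate : ∀ {m n} (f : ℕ → Carrier) → m ≤ n → (∀ k → m ℕ.< k → f k ≈ 0#) →
               ∑≤ n f ≈ ∑≤ m f
  ∑-truncate {zero}  {zero}  f z≤n       f≈0 = refl
  ∑-truncate {zero}  {suc n} f z≤n       f≈0 =
    +-congˡ (∑-zero n λ k _ → f≈0 (suc k) (s≤s z≤n))
  ∑-truncate {suc m} {suc n} f (s≤s m≤n) f≈0 =
    +-congˡ (∑-truncate (f ∘ suc) m≤n λ k m<k → f≈0 (suc k) (s≤s m<k))

module SumHomomorphism {c₁ ℓ₁ c₂ ℓ₂} (R₁ : CommutativeRing c₁ ℓ₁) (R₂ : CommutativeRing c₂ ℓ₂)
  where
  private
    module A = CommutativeRing R₁
    module B = CommutativeRing R₂
    module ∑A = Sum A.rawRing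
    module ∑B = Sum B.rawRing

  ∑-homo : (h : A.Carrier → B.Carrier) → h A.0# B.≈ B.0# →
           (∀ x y → h (x A.+ y) B.≈ h x B.+ h y) →
           ∀ n f → h (∑A.∑≤ n f) B.≈ ∑B.∑≤ n (h ∘ f)
  ∑-homo h h-0 h-+ zero    f = B.trans (h-+ (f 0) A.0#) (B.+-congˡ h-0)
  ∑-homo h h-0 h-+ (suc n) f =
    B.trans (h-+ (f 0) _) (B.+-congˡ (∑-homo h h-0 h-+ n (f ∘ suc)))

-- Derivations and divided powers

module Derivations {c ℓ} (S : CommutativeRing c ℓ) where
  open CommutativeRing S
  open RawSemiringDefs (RawRing.rawSemiring rawRing) using (_^_)
  open SemiringMult semiring using (×-comm-*; ×-assoc-*; ×-congʳ; ×-congˡ; ×-assocˡ)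
    renaming (_×_ to _·_)
  open RingProperties ring using (x+x≈x⇒x≈0)
  open SumProperties S
  open SumHomomorphism S S using (∑-homo)
  open ≈-Reasoning setoid

  record IsDerivation (δ : Carrier → Carrier) : Set (c ⊔ ℓ) where
    field
      cong    : ∀ {x y} → x ≈ y → δ x ≈ δ y
      +-homo  : ∀ x y → δ (x + y) ≈ δ x + δ y
      leibniz : ∀ x y → δ (x * y) ≈ δ x * y + x * δ y

    0-homo : δ 0# ≈ 0#
    0-homo = x+x≈x⇒x≈0 (δ 0#) (trans (sym (+-homo 0# 0#)) (cong (+-identityˡ 0#)))

    ·-homo : ∀ n x → δ (n · x) ≈ n · δ x
    ·-homo zero    x = 0-homo
    ·-homo (suc n) x = trans (+-homo x (n · x)) (+-congˡ (·-homo n x))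

    1-vanish : δ 1# ≈ 0#
    1-vanish = x+x≈x⇒x≈0 (δ 1#) (begin
      δ 1# + δ 1#           ≈⟨ +-cong (*-identityʳ _) (*-identityˡ _) ⟨
      δ 1# * 1# + 1# * δ 1# ≈⟨ leibniz 1# 1# ⟨
      δ (1# * 1#)           ≈⟨ cong (*-identityˡ 1#) ⟩
      δ 1#                  ∎)

    -1-vanish : δ (- 1#) ≈ 0#
    -1-vanish = begin
      δ (- 1#)        ≈⟨ +-identityʳ _ ⟨
      δ (- 1#) + 0#   ≈⟨ +-congˡ 1-vanish ⟨
      δ (- 1#) + δ 1# ≈⟨ +-homo (- 1#) 1# ⟨
      δ (- 1# + 1#)   ≈⟨ cong (-‿inverseˡ 1#) ⟩
      δ 0#            ≈⟨ 0-homo ⟩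
      0#              ∎

    -- Applying δ to `n · u ≈ 1#` gives `n · δ u ≈ 0#`; multiplying by `u`, the inverse of `n`,
    -- cancels the integer.
    1/n-vanish : ∀ n u → n · u ≈ 1# → δ u ≈ 0#
    1/n-vanish n u nu≈1 = begin
      δ u           ≈⟨ *-identityˡ _ ⟨
      1# * δ u      ≈⟨ *-congʳ nu≈1 ⟨
      (n · u) * δ u ≈⟨ ×-assoc-* n u (δ u) ⟩
      n · (u * δ u) ≈⟨ ×-comm-* n u (δ u) ⟨
      u * (n · δ u) ≈⟨ *-congˡ (·-homo n u) ⟨
      u * δ (n · u) ≈⟨ *-congˡ (trans (cong nu≈1) 1-vanish) ⟩
      u * 0#        ≈⟨ zeroʳ u ⟩
      0#            ∎

    leibniz-constantˡ : ∀ {a} x → δ a ≈ 0# → δ (a * x) ≈ a * δ x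
    leibniz-constantˡ {a} x δa≈0 = begin
      δ (a * x)         ≈⟨ leibniz a x ⟩
      δ a * x + a * δ x ≈⟨ +-congʳ (trans (*-congʳ δa≈0) (zeroˡ x)) ⟩
      0# + a * δ x      ≈⟨ +-identityˡ _ ⟩
      a * δ x           ∎

    leibniz-constantʳ : ∀ {a} x → δ a ≈ 0# → δ (x * a) ≈ δ x * a
    leibniz-constantʳ {a} x δa≈0 = begin
      δ (x * a)         ≈⟨ leibniz x a ⟩
      δ x * a + x * δ a ≈⟨ +-congˡ (trans (*-congˡ δa≈0) (zeroʳ x)) ⟩
      δ x * a + 0#      ≈⟨ +-identityʳ _ ⟩
      δ x * a           ∎

    [x-1]-derivation : ∀ x → δ (x - 1#) ≈ δ x
    [x-1]-derivation x = trans (+-homo x (- 1#)) (trans (+-congˡ -1-vanish) (+-identityʳ _))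

    ^-suc : ∀ x k → δ (x ^ suc k) ≈ suc k · (x ^ k * δ x)
    ^-suc x zero    = begin
      δ (x * 1#)         ≈⟨ cong (*-identityʳ x) ⟩
      δ x                ≈⟨ *-identityˡ _ ⟨
      1# * δ x           ≈⟨ +-identityʳ _ ⟨
      1# * δ x + 0#      ∎
    ^-suc x (suc k) = begin
      δ (x * x ^ suc k)                             ≈⟨ leibniz x (x ^ suc k) ⟩
      δ x * x ^ suc k + x * δ (x ^ suc k)           ≈⟨ +-cong (*-comm _ _) (*-congˡ (^-suc x k)) ⟩
      x ^ suc k * δ x + x * (suc k · (x ^ k * δ x)) ≈⟨ +-congˡ (×-comm-* (suc k) x _) ⟩
      x ^ suc k * δ x + suc k · (x * (x ^ k * δ x)) ≈⟨ +-congˡ (×-congʳ (suc k) (*-assoc x _ _)) ⟨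
      suc (suc k) · (x ^ suc k * δ x)               ∎

  -- Replaces division by k!: `ι k` plays the role of 1/k!. Being a bare equation in the ring, the
  -- property passes to constant polynomials and constant series.
  InverseFactorials : (ℕ → Carrier) → Set ℓ
  InverseFactorials ι = ∀ k → (k !) · ι k ≈ 1#

  module _ {ι : ℕ → Carrier} (ι-inv : InverseFactorials ι) where

    -- Uniqueness of inverses: both sides become 1 when multiplied by k!, since k! (k+1) = (k+1)!.
    suc-·-inverseFactorial : ∀ k → suc k · ι (suc k) ≈ ι k
    suc-·-inverseFactorial k = begin
      suc k · ι (suc k)                      ≈⟨ *-identityˡ _ ⟨
      1# * (suc k · ι (suc k))               ≈⟨ *-congʳ (ι-inv k) ⟨
      ((k !) · ι k) * (suc k · ι (suc k))    ≈⟨ ×-assoc-* (k !) _ _ ⟩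
      (k !) · (ι k * (suc k · ι (suc k)))    ≈⟨ ×-comm-* (k !) _ _ ⟨
      ι k * ((k !) · (suc k · ι (suc k)))    ≈⟨ *-congˡ (×-assocˡ _ (k !) (suc k)) ⟩
      ι k * ((k ! ℕ.* suc k) · ι (suc k))    ≈⟨ *-congˡ (×-congˡ (ℕ.*-comm (k !) (suc k))) ⟩
      ι k * ((suc k !) · ι (suc k))          ≈⟨ *-congˡ (ι-inv (suc k)) ⟩
      ι k * 1#                               ≈⟨ *-identityʳ _ ⟩
      ι k                                    ∎

    truncatedExp : ℕ → Carrier → Carrier
    truncatedExp n x = ∑≤ n λ k → ι k * x ^ k

    -- The finite form of δ(eˣ) = eˣ δx. The term `k = 0` is killed, and each x^(k+1)/(k+1)! yields
    -- xᵏ/k! · δx, so the order of truncation drops by exactly one.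
    truncatedExp-derivation : ∀ {δ} → IsDerivation δ → ∀ n x →
                              δ (truncatedExp (suc n) x) ≈ truncatedExp n x * δ x
    truncatedExp-derivation {δ} isδ n x = begin
      δ (ι 0 * 1# + ∑≤ n (λ k → ι (suc k) * x ^ suc k))
        ≈⟨ +-homo _ _ ⟩
      δ (ι 0 * 1#) + δ (∑≤ n (λ k → ι (suc k) * x ^ suc k))
        ≈⟨ +-cong (trans (leibniz-constantˡ 1# (ι-vanish 0)) (trans (*-congˡ 1-vanish) (zeroʳ _)))
                  (∑-homo δ 0-homo +-homo n (λ k → ι (suc k) * x ^ suc k)) ⟩
      0# + ∑≤ n (λ k → δ (ι (suc k) * x ^ suc k))
        ≈⟨ +-identityˡ _ ⟩
      ∑≤ n (λ k → δ (ι (suc k) * x ^ suc k))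
        ≈⟨ ∑-cong n (λ k _ → term k) ⟩
      ∑≤ n (λ k → ι k * x ^ k * δ x)
        ≈⟨ ∑-homo (_* δ x) (zeroˡ _) (distribʳ _) n (λ k → ι k * x ^ k) ⟨
      truncatedExp n x * δ x ∎
      where
      open IsDerivation isδ
      ι-vanish : ∀ k → δ (ι k) ≈ 0#
      ι-vanish k = 1/n-vanish (k !) (ι k) (ι-inv k)
      term : ∀ k → δ (ι (suc k) * x ^ suc k) ≈ ι k * x ^ k * δ x
      term k = begin
        δ (ι (suc k) * x ^ suc k)               ≈⟨ leibniz-constantˡ _ (ι-vanish (suc k)) ⟩
        ι (suc k) * δ (x ^ suc k)               ≈⟨ *-congˡ (^-suc x k) ⟩
        ι (suc k) * (suc k · (x ^ k * δ x))     ≈⟨ ×-comm-* (suc k) _ _ ⟩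
        suc k · (ι (suc k) * (x ^ k * δ x))     ≈⟨ ×-assoc-* (suc k) _ _ ⟨
        (suc k · ι (suc k)) * (x ^ k * δ x)     ≈⟨ *-congʳ (suc-·-inverseFactorial k) ⟩
        ι k * (x ^ k * δ x)                     ≈⟨ *-assoc _ _ _ ⟨
        ι k * x ^ k * δ x                       ∎

-- Formal power series

module SeriesRing {c ℓ} (K : CommutativeRing c ℓ) where
  open CommutativeRing K
  open SumProperties K
  open SumHomomorphism K K using (∑-homo)
  open PowerSeries rawRing public
  open SemiringMult semiring
    using (×-comm-*; ×-assoc-*; ×-congʳ; ×-congˡ; ×-homo-+) renaming (_×_ to _·_)
  open CommutativeMonoidMult +-commutativeMonoid using (×-distrib-+)
  open CommutativeSemigroupProperties +-commutativeSemigroup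
    using () renaming (x∙yz≈y∙xz to x+[y+z]≈y+[x+z])
  open ≈-Reasoning setoid

  open RawRing seriesRawRing public
    using () renaming (_≈_ to _≈ₛ_; _+_ to _+ₛ_; -_ to -ₛ_; 0# to 0ₛ; 1# to 1ₛ)

  ·-zeroʳ : ∀ n → n · 0# ≈ 0#
  ·-zeroʳ zero    = refl
  ·-zeroʳ (suc n) = trans (+-identityˡ _) (·-zeroʳ n)

  0ₛ≈0 : ∀ n → 0ₛ n ≈ 0#
  0ₛ≈0 zero    = refl
  0ₛ≈0 (suc n) = refl

  -- Degree `n` of a product reads its factors only up to degree `n`; this lets a series be
  -- exchanged for a truncation under a product.
  *ₛ-cong-≤ : ∀ n {f f′ g g′ : Series} → (∀ i → i ≤ n → f i ≈ f′ i) → (∀ i → i ≤ n → g i ≈ g′ i) →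
              (f *ₛ g) n ≈ (f′ *ₛ g′) n
  *ₛ-cong-≤ n f≈ g≈ = ∑-cong n λ i i≤n → *-cong (f≈ i i≤n) (g≈ (n ∸ i) (ℕ.m∸n≤m n i))

  *ₛ-zeroʳ-≤ : ∀ n f {g : Series} → (∀ i → i ≤ n → g i ≈ 0#) → (f *ₛ g) n ≈ 0#
  *ₛ-zeroʳ-≤ n f g≈0 = ∑-zero n λ i _ → trans (*-congˡ (g≈0 (n ∸ i) (ℕ.m∸n≤m n i))) (zeroʳ (f i))

  *ₛ-distribʳ : ∀ h f g → ((f +ₛ g) *ₛ h) ≈ₛ ((f *ₛ h) +ₛ (g *ₛ h))
  *ₛ-distribʳ h f g n = trans (∑-cong n λ i _ → distribʳ (h (n ∸ i)) (f i) (g i))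
    (∑-distrib-+ n (λ i → f i * h (n ∸ i)) (λ i → g i * h (n ∸ i)))

  *ₛ-scaleˡ : ∀ a f g n → ((λ i → a * f i) *ₛ g) n ≈ a * (f *ₛ g) n
  *ₛ-scaleˡ a f g n = trans (∑-cong n λ i _ → *-assoc a (f i) (g (n ∸ i)))
    (sym (∑-homo (a *_) (zeroʳ a) (distribˡ a) n λ i → f i * g (n ∸ i)))

  -- The convolution unfolds by splitting off its first term and shifting `f`; this is the mirror
  -- image, splitting off the last term and shifting `g`. Commutativity is the passage from one to
  -- the other.
  *ₛ-sucʳ : ∀ f g n → (f *ₛ g) (suc n) ≈ f (suc n) * g 0 + (f *ₛ (g ∘ suc)) n
  *ₛ-sucʳ f g zero    = x+[y+z]≈y+[x+z] _ _ _
  *ₛ-sucʳ f g (suc n) = trans (+-congˡ (*ₛ-sucʳ (f ∘ suc) g n)) (x+[y+z]≈y+[x+z] _ _ _)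

  *ₛ-comm : ∀ f g → (f *ₛ g) ≈ₛ (g *ₛ f)
  *ₛ-comm f g zero    = +-congʳ (*-comm _ _)
  *ₛ-comm f g (suc n) = begin
    f 0 * g (suc n) + ((f ∘ suc) *ₛ g) n ≈⟨ +-cong (*-comm _ _) (*ₛ-comm (f ∘ suc) g n) ⟩
    g (suc n) * f 0 + (g *ₛ (f ∘ suc)) n ≈⟨ *ₛ-sucʳ g f n ⟨
    (g *ₛ f) (suc n)                     ∎

  -- Induction on the degree: the shift of `f *ₛ g` is `f 0` times the shift of `g` plus the product
  -- of the shift of `f` with `g`, so the induction hypothesis is used at `f ∘ suc`.
  *ₛ-assoc : ∀ f g h → ((f *ₛ g) *ₛ h) ≈ₛ (f *ₛ (g *ₛ h))
  *ₛ-assoc f g h zero    = +-congʳ (begin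
    (f 0 * g 0 + 0#) * h 0 ≈⟨ *-congʳ (+-identityʳ _) ⟩
    f 0 * g 0 * h 0        ≈⟨ *-assoc _ _ _ ⟩
    f 0 * (g 0 * h 0)      ≈⟨ *-congˡ (+-identityʳ _) ⟨
    f 0 * (g 0 * h 0 + 0#) ∎)
  *ₛ-assoc f g h (suc n) = begin
    (f 0 * g 0 + 0#) * h (suc n) + (((f *ₛ g) ∘ suc) *ₛ h) n
      ≈⟨ +-cong (trans (*-congʳ (+-identityʳ _)) (*-assoc _ _ _))
                (*ₛ-distribʳ h (λ i → f 0 * g (suc i)) ((f ∘ suc) *ₛ g) n) ⟩
    f 0 * (g 0 * h (suc n)) + (((λ i → f 0 * g (suc i)) *ₛ h) n + (((f ∘ suc) *ₛ g) *ₛ h) n)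
      ≈⟨ +-congˡ (+-cong (*ₛ-scaleˡ (f 0) (g ∘ suc) h n) (*ₛ-assoc (f ∘ suc) g h n)) ⟩
    f 0 * (g 0 * h (suc n)) + (f 0 * ((g ∘ suc) *ₛ h) n + ((f ∘ suc) *ₛ (g *ₛ h)) n)
      ≈⟨ +-assoc _ _ _ ⟨
    f 0 * (g 0 * h (suc n)) + f 0 * ((g ∘ suc) *ₛ h) n + ((f ∘ suc) *ₛ (g *ₛ h)) n
      ≈⟨ +-congʳ (distribˡ (f 0) _ _) ⟨
    (f *ₛ (g *ₛ h)) (suc n) ∎

  constₛ-* : ∀ a g n → (constₛ a *ₛ g) n ≈ a * g n
  constₛ-* a g zero    = +-identityʳ _
  constₛ-* a g (suc n) = trans (+-congˡ (∑-zero n λ i _ → zeroˡ (g (n ∸ i)))) (+-identityʳ _)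

  seriesIsCommutativeRing : IsCommutativeRing _≈ₛ_ _+ₛ_ _*ₛ_ -ₛ_ 0ₛ 1ₛ
  seriesIsCommutativeRing = record
    { isRing = record
      { +-isAbelianGroup = record
        { isGroup = record
          { isMonoid = record
            { isSemigroup = record
              { isMagma = record
                { isEquivalence = record
                  { refl = λ _ → refl
                  ; sym = λ p n → sym (p n)
                  ; trans = λ p q n → trans (p n) (q n)
                  }
                ; ∙-cong = λ p q n → +-cong (p n) (q n)
                }
              ; assoc = λ f g h n → +-assoc (f n) (g n) (h n)
              }
            ; identity = (λ f n → trans (+-congʳ (0ₛ≈0 n)) (+-identityˡ (f n)))
                       , (λ f n → trans (+-congˡ (0ₛ≈0 n)) (+-identityʳ (f n)))
            }
          ; inverse = (λ f n → trans (-‿inverseˡ (f n)) (sym (0ₛ≈0 n)))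
                    , (λ f n → trans (-‿inverseʳ (f n)) (sym (0ₛ≈0 n)))
          ; ⁻¹-cong = λ p n → -‿cong (p n)
          }
        ; comm = λ f g n → +-comm (f n) (g n)
        }
      ; *-cong = λ p q n → *ₛ-cong-≤ n (λ i _ → p i) (λ i _ → q i)
      ; *-assoc = *ₛ-assoc
      ; *-identity = *ₛ-identityˡ , (λ f n → trans (*ₛ-comm f 1ₛ n) (*ₛ-identityˡ f n))
      ; distrib = (λ f g h n → trans (*ₛ-comm f (g +ₛ h) n) (trans (*ₛ-distribʳ f g h n)
                                 (+-cong (*ₛ-comm g f n) (*ₛ-comm h f n))))
                , *ₛ-distribʳ
      }
    ; *-comm = *ₛ-comm
    }
    where
    *ₛ-identityˡ : ∀ f → (1ₛ *ₛ f) ≈ₛ f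
    *ₛ-identityˡ f n = trans (constₛ-* 1# f n) (*-identityˡ (f n))

  seriesCommutativeRing : CommutativeRing c ℓ
  seriesCommutativeRing = record { isCommutativeRing = seriesIsCommutativeRing }

  private
    module K′ = Derivations K
  open Derivations seriesCommutativeRing
  open RawSemiringDefs (RawRing.rawSemiring seriesRawRing) using () renaming (_×_ to _·ₛ_)
  open SumHomomorphism seriesCommutativeRing K using () renaming (∑-homo to ∑ₛ-homo)

  euler : Series → Series
  euler f n = n · f n

  -- The operator t d/dt multiplies degree n by n, so the Leibniz rule reduces to n = i + (n - i) in
  -- each term of the convolution.
  euler-isDerivation : IsDerivation euler
  euler-isDerivation = record
    { cong    = λ f≈g n → ×-congʳ n (f≈g n)
    ; +-homo  = λ f g n → ×-distrib-+ (f n) (g n) n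
    ; leibniz = λ f g n → begin
        n · (f *ₛ g) n
          ≈⟨ ∑-homo (n ·_) (·-zeroʳ n) (λ x y → ×-distrib-+ x y n) n (λ i → f i * g (n ∸ i)) ⟩
        ∑≤ n (λ i → n · (f i * g (n ∸ i)))
          ≈⟨ ∑-cong n (λ i i≤n → term f g i n i≤n) ⟩
        ∑≤ n (λ i → (i · f i) * g (n ∸ i) + f i * ((n ∸ i) · g (n ∸ i)))
          ≈⟨ ∑-distrib-+ n (λ i → euler f i * g (n ∸ i)) (λ i → f i * euler g (n ∸ i)) ⟩
        (euler f *ₛ g) n + (f *ₛ euler g) n ∎
    }
    where
    term : ∀ (f g : Series) i n → i ≤ n → n · (f i * g (n ∸ i)) ≈
           (i · f i) * g (n ∸ i) + f i * ((n ∸ i) · g (n ∸ i))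
    term f g i n i≤n = begin
      n · (f i * g (n ∸ i))
        ≈⟨ ×-congˡ (ℕ.m+[n∸m]≡n i≤n) ⟨
      (i ℕ.+ (n ∸ i)) · (f i * g (n ∸ i))
        ≈⟨ ×-homo-+ _ i (n ∸ i) ⟩
      i · (f i * g (n ∸ i)) + (n ∸ i) · (f i * g (n ∸ i))
        ≈⟨ +-cong (×-assoc-* i _ _) (×-comm-* (n ∸ i) _ _) ⟨
      (i · f i) * g (n ∸ i) + f i * ((n ∸ i) · g (n ∸ i)) ∎

  d/dt : Series → Series
  d/dt f n = suc n · f (suc n)

  -- d/dt is the shift of euler, and euler f has no constant term.
  d/dt-isDerivation : IsDerivation d/dt
  d/dt-isDerivation = record
    { cong    = λ f≈g n → ×-congʳ (suc n) (f≈g (suc n))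
    ; +-homo  = λ f g n → ×-distrib-+ (f (suc n)) (g (suc n)) (suc n)
    ; leibniz = λ f g n → trans (IsDerivation.leibniz euler-isDerivation f g (suc n)) (+-cong
        (trans (+-congʳ (zeroˡ _)) (+-identityˡ _))
        (trans (*ₛ-sucʳ f (euler g) n) (trans (+-congʳ (zeroʳ _)) (+-identityˡ _))))
    }

  map-isDerivation : ∀ {δ} → K′.IsDerivation δ → IsDerivation (δ ∘_)
  map-isDerivation {δ} isδ = record
    { cong    = λ f≈g n → δ.cong (f≈g n)
    ; +-homo  = λ f g n → δ.+-homo (f n) (g n)
    ; leibniz = λ f g n → trans (∑-homo δ δ.0-homo δ.+-homo n λ i → f i * g (n ∸ i))
        (trans (∑-cong n λ i _ → δ.leibniz (f i) (g (n ∸ i)))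
          (∑-distrib-+ n (λ i → δ (f i) * g (n ∸ i)) (λ i → f i * δ (g (n ∸ i)))))
    }
    where module δ = K′.IsDerivation isδ

  ·ₛ-coefficient : ∀ m f n → (m ·ₛ f) n ≈ m · f n
  ·ₛ-coefficient zero    f n = 0ₛ≈0 n
  ·ₛ-coefficient (suc m) f n = +-congˡ (·ₛ-coefficient m f n)

  constₛ-inverseFactorials : ∀ {ι} → K′.InverseFactorials ι → InverseFactorials (constₛ ∘ ι)
  constₛ-inverseFactorials {ι} ι-inv k zero    =
    trans (·ₛ-coefficient (k !) (constₛ (ι k)) 0) (ι-inv k)
  constₛ-inverseFactorials {ι} ι-inv k (suc n) =
    trans (·ₛ-coefficient (k !) (constₛ (ι k)) (suc n)) (·-zeroʳ (k !))

  -- A series without constant term is divisible by t, hence its k-th power by tᵏ.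
  ^ₛ-order : ∀ f → f 0 ≈ 0# → ∀ k n → n ℕ.< k → (f ^ₛ k) n ≈ 0#
  ^ₛ-order f f₀≈0 (suc k) zero    _         =
    trans (+-identityʳ _) (trans (*-congʳ f₀≈0) (zeroˡ _))
  ^ₛ-order f f₀≈0 (suc k) (suc n) (s≤s n<k) = trans
    (+-cong (trans (*-congʳ f₀≈0) (zeroˡ _))
            (*ₛ-zeroʳ-≤ n (f ∘ suc) λ i i≤n → ^ₛ-order f f₀≈0 k i (ℕ.≤-<-trans i≤n n<k)))
    (+-identityˡ 0#)

  -- The condition under which `δ` can be computed from a truncation. The bound `suc n` is dictated
  -- by `d/dt`, whose coefficient `n` reads coefficient `suc n`.
  Local : (Series → Series) → Set (c ⊔ ℓ)
  Local δ = ∀ f g n → (∀ i → i ≤ suc n → f i ≈ g i) → δ f n ≈ δ g n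

  -- The cutoffs fit exactly: coefficient `n` of `δ` sees degrees up to `suc n`, where the composite
  -- agrees with `T (suc n)`. Differentiation lowers this to `T n`, which agrees with the composite
  -- up to degree `n`, as far as coefficient `n` of the product reaches.
  exp-derivation : ∀ {ι} → K′.InverseFactorials ι → ∀ {f} → f 0 ≈ 0# →
                   ∀ {δ} → IsDerivation δ → Local δ →
                   δ (ι ∘ₛ f) ≈ₛ ((ι ∘ₛ f) *ₛ δ f)
  exp-derivation {ι} ι-inv {f} f₀≈0 {δ} isδ local n = begin
    δ (ι ∘ₛ f) n            ≈⟨ local (ι ∘ₛ f) (T (suc n)) n (λ i i≤ → sym (truncation i≤)) ⟩
    δ (T (suc n)) n         ≈⟨ truncatedExp-derivation ι-invₛ isδ n f n ⟩
    (T n *ₛ δ f) n          ≈⟨ *ₛ-cong-≤ n {g = δ f} (λ i i≤n → truncation i≤n) (λ _ _ → refl) ⟩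
    ((ι ∘ₛ f) *ₛ δ f) n     ∎
    where
    ι-invₛ = constₛ-inverseFactorials ι-inv
    T : ℕ → Series
    T N = truncatedExp ι-invₛ N f
    -- Terms with `i < k` vanish because `f ^ₛ k` starts in degree `k`, so the cutoff `i` built into
    -- the composite can be raised to a common `N`.
    truncation : ∀ {i N} → i ≤ N → T N i ≈ (ι ∘ₛ f) i
    truncation {i} {N} i≤N = begin
      T N i
        ≈⟨ ∑ₛ-homo (λ g → g i) (0ₛ≈0 i) (λ _ _ → refl) N (λ k → constₛ (ι k) *ₛ f ^ₛ k) ⟩
      ∑≤ N (λ k → (constₛ (ι k) *ₛ f ^ₛ k) i)
        ≈⟨ ∑-cong N (λ k _ → constₛ-* (ι k) (f ^ₛ k) i) ⟩
      ∑≤ N (λ k → ι k * (f ^ₛ k) i)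
        ≈⟨ ∑-truncate (λ k → ι k * (f ^ₛ k) i) i≤N (λ k i<k →
             trans (*-congˡ (^ₛ-order f f₀≈0 k i i<k)) (zeroʳ (ι k))) ⟩
      (ι ∘ₛ f) i ∎

-- Polynomials

module PolynomialRing {c ℓ} (R : CommutativeRing c ℓ) where
  open CommutativeRing R
  open Polynomial rawRing public
  open SeriesRing R using
    ( seriesRawRing; seriesIsCommutativeRing; constₛ; _*ₛ_; constₛ-*; *ₛ-cong-≤; ·-zeroʳ; 0ₛ≈0
    ; euler; euler-isDerivation)
  open SumProperties R using (∑-zero)
  open RingProperties ring using (-0#≈0#)
  open SemiringMult semiring using (×-comm-*; ×-assoc-*; ×-congʳ; ×-congˡ) renaming (_×_ to _·_)
  open RawSemiringDefs (RawRing.rawSemiring polyRawRing) using () renaming (_×_ to _·ₚ_)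
  open ≈-Reasoning setoid

  coeff-+ : ∀ p q i → coeff (p +ₚ q) i ≈ coeff p i + coeff q i
  coeff-+ []      q       i       = sym (+-identityˡ _)
  coeff-+ (a ∷ p) []      i       = sym (+-identityʳ _)
  coeff-+ (a ∷ p) (b ∷ q) zero    = refl
  coeff-+ (a ∷ p) (b ∷ q) (suc i) = coeff-+ p q i

  coeff-• : ∀ a p i → coeff (a • p) i ≈ a * coeff p i
  coeff-• a []      i       = sym (zeroʳ a)
  coeff-• a (b ∷ p) zero    = refl
  coeff-• a (b ∷ p) (suc i) = coeff-• a p i

  coeff-neg : ∀ p i → coeff (-ₚ p) i ≈ - coeff p i
  coeff-neg []      i       = sym -0#≈0#
  coeff-neg (a ∷ p) zero    = refl
  coeff-neg (a ∷ p) (suc i) = coeff-neg p i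

  coeff-* : ∀ p q i → coeff (p *ₚ q) i ≈ (coeff p *ₛ coeff q) i
  coeff-* []      q i       = sym (∑-zero i λ k _ → zeroˡ (coeff q (i ∸ k)))
  coeff-* (a ∷ p) q zero    = trans (coeff-+ (a • q) _ 0) (+-congʳ (coeff-• a q 0))
  coeff-* (a ∷ p) q (suc i) =
    trans (coeff-+ (a • q) _ (suc i)) (+-cong (coeff-• a q (suc i)) (coeff-* p q i))

  coeff-const : ∀ a i → coeff (const a) i ≈ constₛ a i
  coeff-const a zero    = refl
  coeff-const a (suc i) = refl

  -- Equality of polynomials is by definition equality of coefficient sequences, so `coeff` embeds
  -- them in the power series in x. The ring laws are pulled back along it instead of being proved
  -- by recursion on lists.
  coeff-isRingMonomorphism : IsRingMonomorphism polyRawRing seriesRawRing coeff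
  coeff-isRingMonomorphism = record
    { isRingHomomorphism = record
      { isSemiringHomomorphism = record
        { isNearSemiringHomomorphism = record
          { +-isMonoidHomomorphism = record
            { isMagmaHomomorphism = record
              { isRelHomomorphism = record { cong = id }
              ; homo = coeff-+
              }
            ; ε-homo = λ i → sym (0ₛ≈0 i)
            }
          ; *-homo = coeff-*
          }
        ; 1#-homo = coeff-const 1#
        }
      ; -‿homo = coeff-neg
      }
    ; injective = id
    }

  polyCommutativeRing : CommutativeRing c ℓ
  polyCommutativeRing = record
    { isCommutativeRing =
        RingMonomorphism.isCommutativeRing coeff-isRingMonomorphism seriesIsCommutativeRing
    }

  private module P = CommutativeRing polyCommutativeRing
  open Derivations polyCommutativeRing
  private module R′ = Derivations R

  coeff-· : ∀ n p i → coeff (n ·ₚ p) i ≈ n · coeff p i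
  coeff-· zero    p i = refl
  coeff-· (suc n) p i = trans (coeff-+ p (n ·ₚ p) i) (+-congˡ (coeff-· n p i))

  const-cong : ∀ {a b} → a ≈ b → const a ≈ₚ const b
  const-cong a≈b zero    = a≈b
  const-cong a≈b (suc i) = refl

  const-*ₚ : ∀ a p → const a *ₚ p ≈ₚ a • p
  const-*ₚ a p i = begin
    coeff (const a *ₚ p) i
      ≈⟨ coeff-* (const a) p i ⟩
    (coeff (const a) *ₛ coeff p) i
      ≈⟨ *ₛ-cong-≤ i {g = coeff p} (λ j _ → coeff-const a j) (λ _ _ → refl) ⟩
    (constₛ a *ₛ coeff p) i
      ≈⟨ constₛ-* a (coeff p) i ⟩
    a * coeff p i
      ≈⟨ coeff-• a p i ⟨
    coeff (a • p) i ∎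

  const-· : ∀ n a → n ·ₚ const a ≈ₚ const (n · a)
  const-· n a zero    = coeff-· n (const a) 0
  const-· n a (suc i) = trans (coeff-· n (const a) (suc i)) (·-zeroʳ n)

  const-inverseFactorials : ∀ {ι} → R′.InverseFactorials ι → InverseFactorials (const ∘ ι)
  const-inverseFactorials {ι} ι-inv k i = trans (const-· (k !) (ι k) i) (const-cong (ι-inv k) i)

  -- Reconciles two forms of the term n l φ: a single scalar acting on a polynomial, as in the
  -- theorem, and `l * (n · φ n)`, as in the recurrence over an abstract ring.
  [n·a]•p≈a*[n·p] : ∀ n a p {b} → b ≈ n · a → b • p ≈ₚ const a *ₚ (n ·ₚ p)
  [n·a]•p≈a*[n·p] n a p {b} b≈n·a i = begin
    coeff (b • p) i                ≈⟨ coeff-• b p i ⟩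
    b * coeff p i                  ≈⟨ *-congʳ b≈n·a ⟩
    (n · a) * coeff p i            ≈⟨ ×-assoc-* n a _ ⟩
    n · (a * coeff p i)            ≈⟨ ×-comm-* n a _ ⟨
    a * (n · coeff p i)            ≈⟨ *-congˡ (coeff-· n p i) ⟨
    a * coeff (n ·ₚ p) i           ≈⟨ coeff-• a (n ·ₚ p) i ⟨
    coeff (a • (n ·ₚ p)) i         ≈⟨ const-*ₚ a (n ·ₚ p) i ⟨
    coeff (const a *ₚ (n ·ₚ p)) i  ∎

  coeff-weighted : ∀ k p i → coeff (weighted k p) i ≈ (k ℕ.+ i) · coeff p i
  coeff-weighted k []      i       = sym (·-zeroʳ (k ℕ.+ i))
  coeff-weighted k (b ∷ p) zero    = ×-congˡ (≡.sym (ℕ.+-identityʳ k))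
  coeff-weighted k (b ∷ p) (suc i) =
    trans (coeff-weighted (suc k) p i) (×-congˡ (≡.sym (ℕ.+-suc k i)))

  x·d/dx : Poly → Poly
  x·d/dx p = X *ₚ d/dx p

  coeff-x·d/dx : ∀ p i → coeff (x·d/dx p) i ≈ i · coeff p i
  coeff-x·d/dx p zero    =
    trans (coeff-* X (d/dx p) 0) (trans (+-identityʳ _) (zeroˡ _))
  coeff-x·d/dx p (suc i) = begin
    coeff (X *ₚ d/dx p) (suc i)
      ≈⟨ coeff-* X (d/dx p) (suc i) ⟩
    0# * coeff (d/dx p) (suc i) + (coeff (const 1#) *ₛ coeff (d/dx p)) i
      ≈⟨ +-cong (zeroˡ _) (sym (coeff-* (const 1#) (d/dx p) i)) ⟩
    0# + coeff (const 1# *ₚ d/dx p) i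
      ≈⟨ trans (+-identityˡ _) (P.*-identityˡ (d/dx p) i) ⟩
    coeff (d/dx p) i
      ≈⟨ coeff-d/dx p ⟩
    suc i · coeff p (suc i) ∎
    where
    coeff-d/dx : ∀ p → coeff (d/dx p) i ≈ suc i · coeff p (suc i)
    coeff-d/dx []      = sym (·-zeroʳ (suc i))
    coeff-d/dx (a ∷ p) = coeff-weighted 1 p i

  -- Multiplication by `X` undoes the shift made by `d/dx`, so under `coeff` the operator becomes
  -- `euler` in the variable x, and its laws are those already shown for series.
  x·d/dx-isDerivation : IsDerivation x·d/dx
  x·d/dx-isDerivation = record
    { cong    = λ {p} {q} p≈q i → begin
        coeff (x·d/dx p) i ≈⟨ coeff-x·d/dx p i ⟩
        i · coeff p i      ≈⟨ ×-congʳ i (p≈q i) ⟩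
        i · coeff q i      ≈⟨ coeff-x·d/dx q i ⟨
        coeff (x·d/dx q) i ∎
    ; +-homo  = λ p q i → begin
        coeff (x·d/dx (p +ₚ q)) i
          ≈⟨ coeff-x·d/dx (p +ₚ q) i ⟩
        i · coeff (p +ₚ q) i
          ≈⟨ ×-congʳ i (coeff-+ p q i) ⟩
        i · (coeff p i + coeff q i)
          ≈⟨ Euler.+-homo (coeff p) (coeff q) i ⟩
        i · coeff p i + i · coeff q i
          ≈⟨ +-cong (coeff-x·d/dx p i) (coeff-x·d/dx q i) ⟨
        coeff (x·d/dx p) i + coeff (x·d/dx q) i
          ≈⟨ coeff-+ (x·d/dx p) (x·d/dx q) i ⟨
        coeff (x·d/dx p +ₚ x·d/dx q) i ∎
    ; leibniz = λ p q i → begin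
        coeff (x·d/dx (p *ₚ q)) i
          ≈⟨ coeff-x·d/dx (p *ₚ q) i ⟩
        i · coeff (p *ₚ q) i
          ≈⟨ ×-congʳ i (coeff-* p q i) ⟩
        i · (coeff p *ₛ coeff q) i
          ≈⟨ Euler.leibniz (coeff p) (coeff q) i ⟩
        (euler (coeff p) *ₛ coeff q) i + (coeff p *ₛ euler (coeff q)) i
          ≈⟨ +-cong (*ₛ-cong-≤ i {g = coeff q} (λ j _ → coeff-x·d/dx p j) (λ _ _ → refl))
                    (*ₛ-cong-≤ i {f = coeff p} (λ _ _ → refl) (λ j _ → coeff-x·d/dx q j)) ⟨
        (coeff (x·d/dx p) *ₛ coeff q) i + (coeff p *ₛ coeff (x·d/dx q)) i
          ≈⟨ +-cong (coeff-* (x·d/dx p) q i) (coeff-* p (x·d/dx q) i) ⟨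
        coeff (x·d/dx p *ₚ q) i + coeff (p *ₚ x·d/dx q) i
          ≈⟨ coeff-+ (x·d/dx p *ₚ q) (p *ₚ x·d/dx q) i ⟨
        coeff (x·d/dx p *ₚ q +ₚ p *ₚ x·d/dx q) i ∎
    }
    where module Euler = Derivations.IsDerivation euler-isDerivation

  x·d/dx-const : ∀ a → x·d/dx (const a) ≈ₚ []
  x·d/dx-const a zero    = coeff-x·d/dx (const a) 0
  x·d/dx-const a (suc i) = trans (coeff-x·d/dx (const a) (suc i)) (·-zeroʳ (suc i))

  x·d/dx-X : x·d/dx X ≈ₚ X
  x·d/dx-X zero          = coeff-x·d/dx X 0
  x·d/dx-X (suc zero)    = trans (coeff-x·d/dx X 1) (+-identityʳ 1#)
  x·d/dx-X (suc (suc i)) = trans (coeff-x·d/dx X (suc (suc i))) (·-zeroʳ (suc (suc i)))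

-- The exponential of x (e − 1)

n!≡nCk*[k!*[n∸k]!] : ∀ {n k} → k ≤ n → n ! ≡.≡ (n C k) ℕ.* (k ! ℕ.* (n ∸ k) !)
n!≡nCk*[k!*[n∸k]!] {n} {k} k≤n = ≡.sym (≡.trans
  (≡.cong (ℕ._* (k ! ℕ.* (n ∸ k) !)) (nCk≡n!/k![n-k]! k≤n))
  (m/n*n≡m {{k ℕ.!* (n ∸ k) !≢0}} (k![n∸k]!∣n! k≤n)))

module _ {c ℓ} (S : CommutativeRing c ℓ) where
  open CommutativeRing S
  open CommutativeSemigroupProperties *-commutativeSemigroup using (x∙yz≈y∙xz)
  open AbelianGroupProperties +-abelianGroup using (xyx⁻¹≈y)
  open ≈-Reasoning setoid

  -- Pure ring algebra: `e′` and `te′` are arbitrary elements standing for e′ and t e′, and the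
  -- hypothesis is (1 + l t) e′ = e. No series for t is needed.
  exponential-factor : ∀ E x l e e′ te′ → e′ + l * te′ ≈ e →
    E * (x * e′) + l * (E * (x * te′)) ≈ x * E + E * (x * (e - 1#))
  exponential-factor E x l e e′ te′ ode = begin
    E * (x * e′) + l * (E * (x * te′))
      ≈⟨ +-congˡ (trans (x∙yz≈y∙xz l E _) (*-congˡ (x∙yz≈y∙xz l x te′))) ⟩
    E * (x * e′) + E * (x * (l * te′))
      ≈⟨ distribˡ E _ _ ⟨
    E * (x * e′ + x * (l * te′))
      ≈⟨ *-congˡ (distribˡ x _ _) ⟨
    E * (x * (e′ + l * te′))
      -- Writing e as 1 + (e - 1) separates x E from E F.
      ≈⟨ *-congˡ (*-congˡ (trans ode (trans (sym (xyx⁻¹≈y 1# e)) (+-assoc 1# e (- 1#))))) ⟩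
    E * (x * (1# + (e - 1#)))
      ≈⟨ *-congˡ (trans (distribˡ x _ _) (+-congʳ (*-identityʳ x))) ⟩
    E * (x + x * (e - 1#))
      ≈⟨ trans (distribˡ E _ _) (+-congʳ (*-comm E x)) ⟩
    x * E + E * (x * (e - 1#)) ∎

module ExponentialRecurrences {c ℓ} (K : CommutativeRing c ℓ) where
  open CommutativeRing K
  open Derivations K
  open SeriesRing K
  open SumProperties K
  open SumHomomorphism K K using (∑-homo)
  open SemiringMult semiring
    using (×-comm-*; ×-congʳ; ×-congˡ; ×-assocˡ) renaming (_×_ to _·_)
  open CommutativeMonoidMult +-commutativeMonoid using (×-distrib-+)
  open ≈-Reasoning setoid
  private
    module S = CommutativeRing seriesCommutativeRing
    module D = Derivations seriesCommutativeRing

  ·-swap : ∀ m n y → m · (n · y) ≈ n · (m · y)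
  ·-swap m n y = begin
    m · (n · y)   ≈⟨ ×-assocˡ y m n ⟩
    (m ℕ.* n) · y ≡⟨ ≡.cong (_· y) (ℕ.*-comm m n) ⟩
    (n ℕ.* m) · y ≈⟨ ×-assocˡ y n m ⟨
    n · (m · y)   ∎

  module _ {ι : ℕ → Carrier} (ι-inv : InverseFactorials ι) (x : Carrier)
           {e : Series} (e₀≈1 : e 0 ≈ 1#) where

    private
      xₛ = constₛ x
      F  = xₛ *ₛ (e -ₛ 1ₛ)
      E  = ι ∘ₛ F

      φ : ℕ → Carrier
      φ n = (n !) · E n

    F₀≈0 : F 0 ≈ 0#
    F₀≈0 = begin
      x * (e 0 - 1#) + 0# ≈⟨ +-identityʳ _ ⟩
      x * (e 0 - 1#)      ≈⟨ *-congˡ (trans (+-congʳ e₀≈1) (-‿inverseʳ 1#)) ⟩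
      x * 0#              ≈⟨ zeroʳ x ⟩
      0#                  ∎

    E-derivation : ∀ {δ} → D.IsDerivation δ → Local δ → δ E ≈ₛ (E *ₛ δ F)
    E-derivation = exp-derivation ι-inv F₀≈0

    E-derivation-t : ∀ {δ} → D.IsDerivation δ → Local δ → δ xₛ ≈ₛ 0ₛ →
                     δ E ≈ₛ (E *ₛ (xₛ *ₛ δ e))
    E-derivation-t {δ} isδ local δx≈0 n = trans (E-derivation isδ local n)
      (*ₛ-cong-≤ n {f = E} (λ _ _ → refl) λ i _ →
        trans (δ.leibniz-constantˡ {xₛ} (e -ₛ 1ₛ) δx≈0 i)
          (*ₛ-cong-≤ i {f = xₛ} (λ _ _ → refl) λ j _ → δ.[x-1]-derivation e j))
      where module δ = D.IsDerivation isδ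

    d/dt-E : d/dt E ≈ₛ (E *ₛ (xₛ *ₛ d/dt e))
    d/dt-E = E-derivation-t d/dt-isDerivation
      (λ f g n f≈g → ×-congʳ (suc n) (f≈g (suc n) ℕ.≤-refl))
      λ n → trans (·-zeroʳ (suc n)) (sym (0ₛ≈0 n))

    euler-E : euler E ≈ₛ (E *ₛ (xₛ *ₛ euler e))
    euler-E = E-derivation-t euler-isDerivation
      (λ f g n f≈g → ×-congʳ n (f≈g n (ℕ.n≤1+n n)))
      λ { zero → refl ; (suc n) → ·-zeroʳ (suc n) }

    -- Differentiating an exponential generating function shifts its sequence by one.
    φ-suc : ∀ n → φ (suc n) ≈ (n !) · d/dt E n
    φ-suc n = trans (sym (×-assocˡ (E (suc n)) (suc n) (n !))) (·-swap (suc n) (n !) (E (suc n)))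

    module _ {θ} (isθ : IsDerivation θ) (θx≈x : θ x ≈ x) (θe≈0 : ∀ n → θ (e n) ≈ 0#)
             {l} (ode : ∀ n → suc n · e (suc n) + l * (n · e n) ≈ e n) where
      private
        module θ = IsDerivation isθ
        module θₛ = D.IsDerivation (map-isDerivation isθ)

      -- `θ` abstracts x d/dx: it fixes x and kills the coefficients of `e`, so it fixes F = x (e -
      -- 1).
      θ-E : (θ ∘ E) ≈ₛ (E *ₛ F)
      θ-E n = trans
        (E-derivation (map-isDerivation isθ) (λ f g n f≈g → θ.cong (f≈g n (ℕ.n≤1+n n))) n)
        (*ₛ-cong-≤ n {f = E} (λ _ _ → refl) λ i _ →
          trans (θₛ.leibniz-constantʳ {e -ₛ 1ₛ} xₛ θ[e-1]≈0 i)
            (*ₛ-cong-≤ i {g = e -ₛ 1ₛ} (λ j _ → θxₛ≈xₛ j) (λ _ _ → refl)))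
        where
        θ[e-1]≈0 : (θ ∘ (e -ₛ 1ₛ)) ≈ₛ 0ₛ
        θ[e-1]≈0 n = trans (θₛ.[x-1]-derivation e n) (trans (θe≈0 n) (sym (0ₛ≈0 n)))
        θxₛ≈xₛ : (θ ∘ xₛ) ≈ₛ xₛ
        θxₛ≈xₛ zero    = θx≈x
        θxₛ≈xₛ (suc n) = θ.0-homo

      E-pde : ∀ n → d/dt E n + l * (n · E n) ≈ x * E n + θ (E n)
      E-pde n = begin
        d/dt E n + l * (n · E n)
          ≈⟨ +-cong (d/dt-E n) (*-congˡ (euler-E n)) ⟩
        (E *ₛ (xₛ *ₛ d/dt e)) n + l * (E *ₛ (xₛ *ₛ euler e)) n
          ≈⟨ +-congˡ (constₛ-* l (E *ₛ (xₛ *ₛ euler e)) n) ⟨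
        (E *ₛ (xₛ *ₛ d/dt e)) n + (constₛ l *ₛ (E *ₛ (xₛ *ₛ euler e))) n
          ≈⟨ exponential-factor seriesCommutativeRing E xₛ (constₛ l) e (d/dt e) (euler e)
               (λ i → trans (+-congˡ (constₛ-* l (euler e) i)) (ode i)) n ⟩
        (xₛ *ₛ E) n + (E *ₛ F) n
          ≈⟨ +-cong (constₛ-* x E n) (sym (θ-E n)) ⟩
        x * E n + θ (E n) ∎

      φ-recurrence : ∀ n → φ (suc n) + l * (n · φ n) ≈ x * φ n + θ (φ n)
      φ-recurrence n = begin
        φ (suc n) + l * (n · φ n)
          ≈⟨ +-cong (φ-suc n) (*-congˡ (·-swap n (n !) (E n))) ⟩
        (n !) · d/dt E n + l * ((n !) · (n · E n))
          ≈⟨ +-congˡ (×-comm-* (n !) l _) ⟩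
        (n !) · d/dt E n + (n !) · (l * (n · E n))
          ≈⟨ ×-distrib-+ _ _ (n !) ⟨
        (n !) · (d/dt E n + l * (n · E n))
          ≈⟨ ×-congʳ (n !) (E-pde n) ⟩
        (n !) · (x * E n + θ (E n))
          ≈⟨ ×-distrib-+ _ _ (n !) ⟩
        (n !) · (x * E n) + (n !) · θ (E n)
          ≈⟨ +-cong (×-comm-* (n !) x _) (θ.·-homo (n !) _) ⟨
        x * φ n + θ (φ n) ∎

    module _ {b : ℕ → Carrier} (e′-coefficient : ∀ n → (n !) · (suc n · e (suc n)) ≈ b n) where

      -- The product rule for exponential generating functions: n! splits as the binomial
      -- coefficient times k! (n - k)!, where k! turns `E k` into `φ k` and (n - k)! turns the
      -- coefficient of e′ into `b (n ∸ k)`.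
      φ-convolution : ∀ n → φ (suc n) ≈ x * ∑≤ n (λ k → (n C k) · (b (n ∸ k) * φ k))
      φ-convolution n = begin
        φ (suc n)
          ≈⟨ φ-suc n ⟩
        (n !) · d/dt E n
          ≈⟨ ×-congʳ (n !) (trans (d/dt-E n) (x∙yz≈y∙xz E xₛ (d/dt e) n)) ⟩
        (n !) · (xₛ *ₛ (E *ₛ d/dt e)) n
          ≈⟨ ×-congʳ (n !) (constₛ-* x (E *ₛ d/dt e) n) ⟩
        (n !) · (x * (E *ₛ d/dt e) n)
          ≈⟨ ×-comm-* (n !) x _ ⟨
        x * ((n !) · (E *ₛ d/dt e) n)
          ≈⟨ *-congˡ (∑-homo ((n !) ·_) (·-zeroʳ (n !)) (λ y z → ×-distrib-+ y z (n !)) n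
               (λ k → E k * d/dt e (n ∸ k))) ⟩
        x * ∑≤ n (λ k → (n !) · (E k * d/dt e (n ∸ k)))
          ≈⟨ *-congˡ (∑-cong n term) ⟩
        x * ∑≤ n (λ k → (n C k) · (b (n ∸ k) * φ k)) ∎
        where
        open CommutativeSemigroupProperties S.*-commutativeSemigroup using (x∙yz≈y∙xz)
        term : ∀ k → k ≤ n → (n !) · (E k * d/dt e (n ∸ k)) ≈ (n C k) · (b (n ∸ k) * φ k)
        term k k≤n = begin
          (n !) · (E k * d/dt e j)
            ≈⟨ ×-congˡ (n!≡nCk*[k!*[n∸k]!] k≤n) ⟩
          ((n C k) ℕ.* (k ! ℕ.* j !)) · (E k * d/dt e j)
            ≈⟨ ×-assocˡ _ (n C k) (k ! ℕ.* j !) ⟨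
          (n C k) · ((k ! ℕ.* j !) · (E k * d/dt e j))
            ≈⟨ ×-congʳ (n C k) (×-assocˡ _ (k !) (j !)) ⟨
          (n C k) · ((k !) · ((j !) · (E k * d/dt e j)))
            ≈⟨ ×-congʳ (n C k) (×-congʳ (k !) (×-comm-* (j !) _ _)) ⟨
          (n C k) · ((k !) · (E k * ((j !) · d/dt e j)))
            ≈⟨ ×-congʳ (n C k) (×-congʳ (k !) (trans (*-congˡ (e′-coefficient j)) (*-comm _ _))) ⟩
          (n C k) · ((k !) · (b j * E k))
            ≈⟨ ×-congʳ (n C k) (×-comm-* (k !) _ _) ⟨
          (n C k) · (b j * φ k) ∎
          where j = n ∸ k

-- Degenerate Bell polynomials

module DegenerateBellProperties {c ℓ} (R : CommutativeRing c ℓ)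
  (fromℚ : ℚ → CommutativeRing.Carrier R)
  (1/!-inv : Derivations.InverseFactorials R
               (DegenerateBell.1/_! (CommutativeRing.rawRing R) fromℚ))
  (l : CommutativeRing.Carrier R)
  where

  open CommutativeRing R
  open DegenerateBell rawRing fromℚ
  open PolynomialRing R
  open SumProperties polyCommutativeRing using (∑≤; ∑-cong)
  open SemiringMult semiring using (×-comm-*; ×-assoc-*; ×-congʳ) renaming (_×_ to _·_)
  open RawSemiringDefs (RawRing.rawSemiring polyRawRing) using () renaming (_×_ to _·ₚ_)
  open ≈-Reasoning setoid
  private
    module P = CommutativeRing polyCommutativeRing
    module ×P = SemiringMult P.semiring
    module Rec = ExponentialRecurrences polyCommutativeRing

    a : ℕ → Carrier
    a n = falling 1# n l * 1/ n !

  -- The first factor of (1)_{k+1,l} is 1, and each later one is 1 - (j+1) l = (1 - l) - j l.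
  falling-1 : ∀ {y} → y ≈ 1# - l → ∀ k → falling 1# (suc k) l ≈ falling y k l
  falling-1         y≈1-l zero    = begin
    1# * (1# - 0#) ≈⟨ *-identityˡ _ ⟩
    1# - 0#        ≈⟨ +-congˡ -0#≈0# ⟩
    1# + 0#        ≈⟨ +-identityʳ _ ⟩
    1#             ∎
    where open RingProperties ring using (-0#≈0#)
  falling-1 {y} y≈1-l (suc k) = *-cong (falling-1 y≈1-l k) (begin
    1# - (l + k · l)       ≈⟨ +-congˡ (⁻¹-∙-comm l (k · l)) ⟨
    1# + (- l - k · l)     ≈⟨ +-assoc _ _ _ ⟨
    1# - l - k · l         ≈⟨ +-congʳ y≈1-l ⟨
    y - k · l              ∎)
    where open AbelianGroupProperties +-abelianGroup using (⁻¹-∙-comm)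

  suc-·-a : ∀ n → suc n · a (suc n) ≈ falling 1# (suc n) l * 1/ n !
  suc-·-a n = trans (sym (×-comm-* (suc n) _ _))
    (*-congˡ (Derivations.suc-·-inverseFactorial R 1/!-inv n))

  a₀≈1 : a 0 ≈ 1#
  a₀≈1 = trans (*-identityˡ _) (trans (sym (+-identityʳ _)) (1/!-inv 0))

  -- (1 + l t) e_l′(t) = e_l(t)
  a-ode : ∀ n → suc n · a (suc n) + l * (n · a n) ≈ a n
  a-ode n = begin
    suc n · a (suc n) + l * (n · a n)
      ≈⟨ +-cong (suc-·-a n) (trans (×-comm-* n l _) (sym (×-assoc-* n l _))) ⟩
    falling 1# n l * (1# - n · l) * 1/ n ! + (n · l) * a n
      ≈⟨ +-cong (xy∙z≈xz∙y _ _ _) (*-comm _ _) ⟩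
    a n * (1# - n · l) + a n * (n · l)
      ≈⟨ distribˡ (a n) _ _ ⟨
    a n * (1# - n · l + n · l)
      ≈⟨ *-congˡ (trans (+-assoc _ _ _) (trans (+-congˡ (-‿inverseˡ _)) (+-identityʳ _))) ⟩
    a n * 1#
      ≈⟨ *-identityʳ _ ⟩
    a n ∎
    where open CommutativeSemigroupProperties *-commutativeSemigroup using (xy∙z≈xz∙y)

  n!·[1+n]·a : ∀ {y} → y ≈ 1# - l → ∀ n → (n !) · (suc n · a (suc n)) ≈ falling y n l
  n!·[1+n]·a {y} y≈1-l n = begin
    (n !) · (suc n · a (suc n))                ≈⟨ ×-congʳ (n !) (suc-·-a n) ⟩
    (n !) · (falling 1# (suc n) l * 1/ n !)    ≈⟨ ×-comm-* (n !) _ _ ⟨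
    falling 1# (suc n) l * ((n !) · 1/ n !)    ≈⟨ *-cong (falling-1 y≈1-l n) (1/!-inv n) ⟩
    falling y n l * 1#                         ≈⟨ *-identityʳ _ ⟩
    falling y n l                              ∎

  φ-recurrence : ∀ n {b} → b ≈ n · l →
    φ (suc n) l ≈ₚ X *ₚ φ n l +ₚ (X *ₚ d/dx (φ n l) -ₚ b • φ n l)
  φ-recurrence n {b} b≈n·l i = begin
    coeff (φ (suc n) l) i
      -- The abstract recurrence carries n l φ as a summand on the left; it is moved across
      -- coefficient by coefficient.
      ≈⟨ x≈z-y {y = coeff (const l *ₚ (n ·ₚ φ n l)) i} (begin
           coeff (φ (suc n) l) i + coeff (const l *ₚ (n ·ₚ φ n l)) i
             ≈⟨ coeff-+ (φ (suc n) l) (const l *ₚ (n ·ₚ φ n l)) i ⟨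
           coeff (φ (suc n) l +ₚ const l *ₚ (n ·ₚ φ n l)) i
             ≈⟨ Rec.φ-recurrence {expₛ} (const-inverseFactorials 1/!-inv) X {degExpₛ l}
                  (const-cong a₀≈1) x·d/dx-isDerivation x·d/dx-X (λ k → x·d/dx-const (a k))
                  {const l} ode n i ⟩
           coeff (X *ₚ φ n l +ₚ x·d/dx (φ n l)) i ∎) ⟩
    coeff (X *ₚ φ n l +ₚ x·d/dx (φ n l)) i - coeff (const l *ₚ (n ·ₚ φ n l)) i
      ≈⟨ +-cong (coeff-+ (X *ₚ φ n l) (x·d/dx (φ n l)) i)
                (trans (-‿cong (sym ([n·a]•p≈a*[n·p] n l (φ n l) b≈n·l i)))
                       (sym (coeff-neg (b • φ n l) i))) ⟩
    coeff (X *ₚ φ n l) i + coeff (x·d/dx (φ n l)) i + coeff (-ₚ (b • φ n l)) i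
      ≈⟨ +-assoc _ _ _ ⟩
    coeff (X *ₚ φ n l) i + (coeff (x·d/dx (φ n l)) i + coeff (-ₚ (b • φ n l)) i)
      ≈⟨ +-congˡ (coeff-+ (x·d/dx (φ n l)) (-ₚ (b • φ n l)) i) ⟨
    coeff (X *ₚ φ n l) i + coeff (x·d/dx (φ n l) -ₚ b • φ n l) i
      ≈⟨ coeff-+ (X *ₚ φ n l) (x·d/dx (φ n l) -ₚ b • φ n l) i ⟨
    coeff (X *ₚ φ n l +ₚ (x·d/dx (φ n l) -ₚ b • φ n l)) i ∎
    where
    x≈z-y : ∀ {x y z} → x + y ≈ z → x ≈ z - y
    x≈z-y {x} {y} {z} x+y≈z = begin
      x           ≈⟨ +-identityʳ x ⟨
      x + 0#      ≈⟨ +-congˡ (-‿inverseʳ y) ⟨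
      x + (y - y) ≈⟨ +-assoc x y (- y) ⟨
      x + y - y   ≈⟨ +-congʳ x+y≈z ⟩
      z - y       ∎
    ode : ∀ k → suc k ·ₚ const (a (suc k)) +ₚ const l *ₚ (k ·ₚ const (a k)) ≈ₚ const (a k)
    ode k i = begin
      coeff (suc k ·ₚ const (a (suc k)) +ₚ const l *ₚ (k ·ₚ const (a k))) i
        ≈⟨ coeff-+ (suc k ·ₚ const (a (suc k))) (const l *ₚ (k ·ₚ const (a k))) i ⟩
      coeff (suc k ·ₚ const (a (suc k))) i + coeff (const l *ₚ (k ·ₚ const (a k))) i
        ≈⟨ +-cong (const-· (suc k) (a (suc k)) i)
                  (trans (P.*-congˡ {const l} {k ·ₚ const (a k)} {const (k · a k)}
                           (const-· k (a k)) i)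
                         (const-*ₚ l (const (k · a k)) i)) ⟩
      coeff (const (suc k · a (suc k))) i + coeff (const (l * (k · a k))) i
        ≈⟨ coeff-+ (const (suc k · a (suc k))) (const (l * (k · a k))) i ⟨
      coeff (const (suc k · a (suc k) + l * (k · a k))) i
        ≈⟨ const-cong (a-ode k) i ⟩
      coeff (const (a k)) i ∎

  φ-convolution : ∀ n {y} → y ≈ 1# - l → ∀ {c : ℕ → Carrier} → (∀ k → c k ≈ falling y k l) →
    φ (suc n) l ≈ₚ X *ₚ ∑≤ n (λ k → (n C k) ·ₚ (c (n ∸ k) • φ k l))
  φ-convolution n y≈1-l {c} c≈ i = begin
    coeff (φ (suc n) l) i
      ≈⟨ Rec.φ-convolution {expₛ} (const-inverseFactorials 1/!-inv) X {degExpₛ l}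
           (const-cong a₀≈1) {b} e′-coefficient n i ⟩
    coeff (X *ₚ ∑≤ n f) i
      ≈⟨ P.*-congˡ {X} {∑≤ n f} {∑≤ n g} (∑-cong n {f} {g} λ k _ →
           ×P.×-congʳ (n C k) {b (n ∸ k) *ₚ φ k l} {c (n ∸ k) • φ k l}
             (const-*ₚ (c (n ∸ k)) (φ k l))) i ⟩
    coeff (X *ₚ ∑≤ n g) i ∎
    where
    b f g : ℕ → Poly
    b k = const (c k)
    f k = (n C k) ·ₚ (b (n ∸ k) *ₚ φ k l)
    g k = (n C k) ·ₚ (c (n ∸ k) • φ k l)
    e′-coefficient : ∀ k → (k !) ·ₚ (suc k ·ₚ const (a (suc k))) ≈ₚ b k
    e′-coefficient k i = begin
      coeff ((k !) ·ₚ (suc k ·ₚ const (a (suc k)))) i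
        ≈⟨ ×P.×-congʳ (k !) {suc k ·ₚ const (a (suc k))} {const (suc k · a (suc k))}
             (const-· (suc k) (a (suc k))) i ⟩
      coeff ((k !) ·ₚ const (suc k · a (suc k))) i
        ≈⟨ const-· (k !) (suc k · a (suc k)) i ⟩
      coeff (const ((k !) · (suc k · a (suc k)))) i
        ≈⟨ const-cong (trans (n!·[1+n]·a y≈1-l k) (sym (c≈ k))) i ⟩
      coeff (b k) i ∎

-- At R = ℝ-rawRing two real numbers that do not agree syntactically are compared by unfolding
-- their Cauchy moduli, which is infeasible.  Hence the raw ring, the scalars b and c given only
-- up to ≈, and the record, whose parameters are compared without unfolding its fields.
module DegenerateBellRecurrences {c ℓ} (R : RawRing c ℓ) (fromℚ : ℚ → RawRing.Carrier R) where
  open RawRing R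
  open DegenerateBell R fromℚ
  open Polynomial R
  open Sum polyRawRing
  open RawSemiringDefs rawSemiring using () renaming (_×_ to _·_)
  open RawSemiringDefs (RawRing.rawSemiring polyRawRing) using () renaming (_×_ to _·ₚ_)

  record Recurrences (l : Carrier) (n : ℕ) (b : Carrier) (c : ℕ → Carrier) : Set ℓ where
    field
      differential : φ (suc n) l ≈ₚ X *ₚ φ n l +ₚ (X *ₚ d/dx (φ n l) -ₚ b • φ n l)
      convolution  : X *ₚ φ n l +ₚ (X *ₚ d/dx (φ n l) -ₚ b • φ n l)
                     ≈ₚ X *ₚ ∑≤ n (λ k → (n C k) ·ₚ (c (n ∸ k) • φ k l))

  module _ (isCommutativeRing : IsCommutativeRing _≈_ _+_ _*_ -_ 0# 1#)
           (1/!-inv : ∀ k → (k !) · 1/ k ! ≈ 1#)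
           where
    open IsCommutativeRing isCommutativeRing using (trans; sym)

    private
      ring : CommutativeRing c ℓ
      ring = record { isCommutativeRing = isCommutativeRing }
      module Properties = DegenerateBellProperties ring fromℚ 1/!-inv

    recurrences : ∀ l n {b y} {c : ℕ → Carrier} →
                  b ≈ n · l → y ≈ 1# + - l → (∀ k → c k ≈ falling y k l) → Recurrences l n b c
    recurrences l n b≈ y≈ c≈ = record
      { differential = φ-recurrence n b≈
      ; convolution  = λ i → trans (sym (φ-recurrence n b≈ i)) (φ-convolution n y≈ c≈ i)
      }
      where open Properties l

-- The real numbers

open RawMonoidDefs ℚ.+-0-rawMonoid using () renaming (_×_ to _·ℚ_)

-- Normalised rationals reduce every sum by a gcd. On unnormalised fractions the induction step is
-- one cross-multiplication over a fixed denominator, with the numerator `n` free for induction.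
n·1/d≃n/d : ∀ n d-1 → toℚᵘ (n ·ℚ (ℤ.+ 1 ℚ./ suc d-1)) ℚᵘ.≃ mkℚᵘ (ℤ.+ n) d-1
n·1/d≃n/d zero    d-1 = *≡* ≡.refl
n·1/d≃n/d (suc n) d-1 = begin
  toℚᵘ (q ℚ.+ n ·ℚ q)
    ≈⟨ ℚ.toℚᵘ-homo-+ q (n ·ℚ q) ⟩
  toℚᵘ q ℚᵘ.+ toℚᵘ (n ·ℚ q)
    ≈⟨ ℚᵘ.+-cong (ℚ.toℚᵘ-fromℚᵘ (mkℚᵘ (ℤ.+ 1) d-1)) (n·1/d≃n/d n d-1) ⟩
  mkℚᵘ (ℤ.+ 1) d-1 ℚᵘ.+ mkℚᵘ (ℤ.+ n) d-1
    ≈⟨ *≡* (common-denominator (ℤ.+ 1) (ℤ.+ n) (ℤ.+ suc d-1)) ⟩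
  mkℚᵘ (ℤ.+ suc n) d-1 ∎
  where
  open ≈-Reasoning ℚᵘ.≃-setoid
  q = ℤ.+ 1 ℚ./ suc d-1
  common-denominator : ∀ a b d → (a ℤ.* d ℤ.+ b ℤ.* d) ℤ.* d ≡.≡ (a ℤ.+ b) ℤ.* (d ℤ.* d)
  common-denominator = solve-∀

n·1/n≡1 : ∀ n .{{_ : ℕ.NonZero n}} → n ·ℚ (ℤ.+ 1 ℚ./ n) ≡.≡ 1ℚ
n·1/n≡1 (suc n) = ℚ.toℚᵘ-injective
  (ℚᵘ.≃-trans (n·1/d≃n/d (suc n) n) (*≡* (ℤ.*-comm (ℤ.+ suc n) (ℤ.+ 1))))

open import Defs

private module ℝ-ring = CommutativeRing ℝ-commutativeRing

fromℚ-· : ∀ n q → n ·ᵣ fromℚ q ≃ fromℚ (n ·ℚ q)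
fromℚ-· zero    q = ℝ-ring.refl {0ᵣ}
-- The sum of two constant reals and the constant real of the sum differ only in their Cauchy
-- witnesses; `≃` reads only the sequences, which agree definitionally.
fromℚ-· (suc n) q = ℝ-ring.+-congˡ {fromℚ q} {n ·ᵣ fromℚ q} {fromℚ (n ·ℚ q)} (fromℚ-· n q)

1/!-inverseFactorials : ∀ k → (k !) ·ᵣ DegenerateBell.1/_! ℝ-rawRing fromℚ k ≃ 1ᵣ
1/!-inverseFactorials k =
  ≡.subst (λ q → (k !) ·ᵣ fromℚ 1/k! ≃ fromℚ q) (n·1/n≡1 (k !) {{k ℕ.!≢0}}) (fromℚ-· (k !) 1/k!)
  where
  1/k! : ℚ
  1/k! = ℚ._/_ (ℤ.+ 1) (k !) {{k ℕ.!≢0}}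

theorem11 : (l : ℝ) → ¬ (l ≃ 0ᵣ) → (n : ℕ) → 1 ≤ n →
    (φ (suc n) l ≈ₚ X *ₚ φ n l +ₚ (X *ₚ d/dx (φ n l) -ₚ (n ·ᵣ l) • φ n l))
    ×
    (X *ₚ φ n l +ₚ (X *ₚ d/dx (φ n l) -ₚ (n ·ᵣ l) • φ n l)
    ≈ₚ X *ₚ ∑ₚ≤ n (λ k → (n C k) ·ₚ (falling (1ᵣ +ᵣ -ᵣ l) (n ∸ k) l • φ k l)))
theorem11 l _ n _ = Recurrences.differential r , Recurrences.convolution r
  where
  open DegenerateBellRecurrences ℝ-rawRing fromℚ
  r : Recurrences l n (n ·ᵣ l) (λ k → falling (1ᵣ +ᵣ -ᵣ l) k l)
  r = recurrences ℝ-ring.isCommutativeRing 1/!-inverseFactorials l n {n ·ᵣ l} {1ᵣ +ᵣ -ᵣ l}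
        (ℝ-ring.refl {n ·ᵣ l}) (ℝ-ring.refl {1ᵣ +ᵣ -ᵣ l})
        (λ k → ℝ-ring.refl {falling (1ᵣ +ᵣ -ᵣ l) k l})
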